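{- Let $D$ be a graded digraph on $n$ vertices with maximum degree $\Delta$. Then \[ \vec r(D) \leq 10^9 \Delta^3 2^{4\Delta} n. \] More precisely, if $D$ has maximum in-degree $\Delta^-$ and maximum out-degree $\Delta^+$, then \[ \vec r(D) \leq 10^9 \Delta^+ (\Delta^-)^2 2^{4\Delta^- } n. \]
   Context: A tournament is an orientation of a complete graph. For an acyclic digraph $G$, the oriented Ramsey number $\vec r(G)$ is the smallest integer $N$ such that every tournament on $N$ vertices contains a copy of $G$ (as a subgraph, respecting orientations). A digraph $G$ is graded if its vertex set can be partitioned as $V(G)=V_1\cup\dots\cup V_H$ so that every edge is directed from $V_i$ to $V_{i+1}$ for some $i\in[H-1]$ (such digraphs are acyclic). The maximum degree of a digraph is the maximum degree of its underlying undirected graph.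
   Formalization: The digraph D is assumed to have at least one edge (Δ ≥ 1); for an edgeless D on n ≥ 1 vertices both upper bounds equal 0 while the oriented Ramsey number is n, so the claim fails there. -}

module Defs where

open import Data.Nat using (ℕ; zero; suc; _+_; _*_; _^_; _≤_; _⊔_)
open import Data.Bool using (Bool; true; false; _∨_; if_then_else_)
open import Data.Fin using (Fin; zero; suc)
open import Data.Product using (Σ; ∃; _×_; _,_)
open import Relation.Binary.PropositionalEquality using (_≡_)
open import Relation.Nullary using (¬_)
open import Function.Definitions using (Injective)

-- A digraph on vertex set Fin n, given by its (Boolean) adjacency relation:
-- E u v ≡ true  means there is an edge directed from u to v.
Digraph : ℕ → Set
Digraph n = Fin n → Fin n → Bool

count : {n : ℕ} → (Fin n → Bool) → ℕ
count {zero}  p = 0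
count {suc n} p = (if p zero then 1 else 0) + count (λ i → p (suc i))

maxFin : {n : ℕ} → (Fin n → ℕ) → ℕ
maxFin {zero}  f = 0
maxFin {suc n} f = f zero ⊔ maxFin (λ i → f (suc i))

outDeg : {n : ℕ} → Digraph n → Fin n → ℕ
outDeg E v = count (λ u → E v u)

inDeg : {n : ℕ} → Digraph n → Fin n → ℕ
inDeg E v = count (λ u → E u v)

deg : {n : ℕ} → Digraph n → Fin n → ℕ
deg E v = count (λ u → E v u ∨ E u v)

maxOutDeg maxInDeg maxDeg : {n : ℕ} → Digraph n → ℕ
maxOutDeg E = maxFin (outDeg E)
maxInDeg  E = maxFin (inDeg E)
maxDeg    E = maxFin (deg E)

-- Graded: V = V_1 ∪ … ∪ V_H with every edge going from some V_i to V_{i+1}.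
-- Encoded by a level function (vertex v lies in V_{level v + 1}).
Graded : {n : ℕ} → Digraph n → Set
Graded {n} E = Σ ℕ λ H → Σ (Fin n → Fin H) λ level →
  ∀ u v → E u v ≡ true → Data.Fin.toℕ (level v) ≡ suc (Data.Fin.toℕ (level u))

IsTournament : {N : ℕ} → Digraph N → Set
IsTournament {N} T =
  (∀ u → T u u ≡ false) ×
  (∀ u v → ¬ (u ≡ v) → (T u v ≡ true × T v u ≡ false) Data.Sum.⊎ (T u v ≡ false × T v u ≡ true))
  where import Data.Sum

Contains : {N n : ℕ} → Digraph N → Digraph n → Set
Contains {N} {n} T D = Σ (Fin n → Fin N) λ f →
  Injective _≡_ _≡_ f × (∀ u v → D u v ≡ true → T (f u) (f v) ≡ true)

Arrows : ℕ → {n : ℕ} → Digraph n → Set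
Arrows N D = (T : Digraph N) → IsTournament T → Contains T D

-- r⃗(D) ≤ M : the smallest N such that every N-vertex tournament contains D
-- exists and is at most M, i.e. some N ≤ M has the property.
OrientedRamseyAtMost : {n : ℕ} → Digraph n → ℕ → Set
OrientedRamseyAtMost D M = Σ ℕ λ N → N ≤ M × Arrows N D

{-# OPTIONS --safe #-}

-- In a median order of the tournament every vertex y receives edges from at least half of any
-- interval ending just before y.  Process the levels V_i of D from the last to the first: given
-- U_{i+1} inside a short window of the order, a somewhat longer interval just before that window
-- has density almost 1/2 towards U_{i+1}, hence so has one of the short blocks J_i that it splits
-- into.  Dependent random choice (U_i is the common in-neighbourhood in J_i of s random vertices of
-- U_{i+1}) makes almost every Δ⁻-tuple of U_i have many common out-neighbours in U_{i+1}.  Then D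
-- is embedded greedily from the first level to the last: each vertex of V_i is put into the common
-- out-neighbourhood of its in-neighbours, so that for every vertex of V_{i+1} almost all
-- completions of the image of its in-neighbourhood remain good.
module Submission where

open import Defs
open import Data.Bool using (Bool; true; false; _∧_; _∨_; not; if_then_else_; T?)
open import Data.Bool.ListAction using (all)
open import Data.Bool.Properties using (∧-zeroʳ; ∨-zeroʳ)
open import Data.Empty using (⊥-elim)
open import Data.Fin using (Fin; zero; suc; toℕ; fromℕ<)
import Data.Fin.Properties as Fin
open import Data.List using (List; []; _∷_; _++_; length; map; filterᵇ; allFin; tabulate; take; drop; downFrom)
open import Data.List.Membership.Propositional using (_∈_; _∉_)
open import Data.List.Membership.Propositional.Properties
  using (∈-allFin; ∈-map⁺; ∈-++⁺ˡ; ∈-++⁺ʳ; ∈-filter⁺; ∈-filter⁻; ∈-∃++; ∈-downFrom⁻)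
open import Data.List.Properties
  using (map-++; ++-assoc; ++-identityʳ; length-++; take++drop≡id; length-take; length-downFrom; length-tabulate)
open import Data.List.Relation.Binary.Permutation.Propositional using (_↭_; ↭-refl; ↭-trans; ↭⇒↭ₛ)
open import Data.List.Relation.Binary.Permutation.Propositional.Properties using (shift; ++⁺ˡ; ↭-length)
import Data.List.Relation.Binary.Permutation.Setoid.Properties as Perm
open import Data.List.Relation.Binary.Subset.Propositional using (_⊆_)
open import Data.List.Relation.Binary.Subset.Propositional.Properties using (∷⁺ʳ)
open import Data.List.Relation.Unary.All using (All; []; _∷_; lookup)
open import Data.List.Relation.Unary.All.Properties using (++⁻ˡ)
open import Data.List.Relation.Unary.AllPairs using ([]; _∷_)
open import Data.List.Relation.Unary.Any using (here; there)
open import Data.List.Relation.Unary.Unique.Propositional using (Unique)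
open import Data.List.Relation.Unary.Unique.Propositional.Properties using (filter⁺; allFin⁺; downFrom⁺)
open import Data.Nat using (ℕ; zero; suc; pred; _+_; _*_; _^_; _∸_; _≤_; _<_; _≡ᵇ_; _<ᵇ_; _≤ᵇ_; z≤n; s≤s; NonZero; >-nonZero; >-nonZero⁻¹)
open import Data.Nat.DivMod using (_/_; _%_; m≡m%n+[m/n]*n; m%n<n)
open import Data.Nat.ListAction using (sum)
open import Data.Nat.ListAction.Properties using (sum-++)
open import Data.Nat.Properties
open import Data.Nat.Tactic.RingSolver using (solve-∀)
open import Data.Product using (∃; ∃₂; _×_; _,_; proj₁; proj₂; map₂)
open import Data.Sum using (_⊎_; inj₁; inj₂)
open import Function using (_∘_)
open import Relation.Binary.PropositionalEquality hiding (J)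
open import Relation.Nullary using (Dec; yes; no; does)
open import Relation.Nullary.Decidable using (dec-true; dec-false)

-- Neighbouring levels may differ wildly in size. For density close to 1/2 the interval in front of
-- the window of U_{i+1} must be long compared with that window, while dependent random choice for
-- level i needs a block of length a fixed multiple of `size i`, since it compares
-- `length J ^ suc d` with a power of `size i`. Hence the passage from the interval to a short
-- block; afterwards all sizes cancel and the conditions left over involve only `d`, `D`, `a`, `B`,
-- `R` and `s`. The sets U_i are built backwards but D is embedded forwards. `Ready` reconciles
-- this: what is carried backwards is a function that embeds the remaining levels once their
-- candidate sets are known. `B = 4 ^ (d + 1)` is forced by powers of a density near 1/2, and `R` is
-- of order `D * B`. The windows together have length of order `d * B * R * n`, that is
-- `d * D * B ^ 2 * n`, which is where `2 ^ (4 * d)` comes from. Probabilities appear with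
-- denominators cleared, as sums over ordered tuples with repetitions.

private
  variable
    A A′ : Set

-- Sums over lists and tuples

T⁻ : ∀ {b} → Data.Bool.T b → b ≡ true
T⁻ {true} _ = refl

T⁺ : ∀ {b} → b ≡ true → Data.Bool.T b
T⁺ refl = _

∑ : List A → (A → ℕ) → ℕ
∑ xs f = sum (map f xs)

𝟙 : Bool → ℕ
𝟙 b = if b then 1 else 0

# : (A → Bool) → List A → ℕ
# p xs = ∑ xs (𝟙 ∘ p)

𝟙-∧ : ∀ a b → 𝟙 (a ∧ b) ≡ 𝟙 a * 𝟙 b
𝟙-∧ true  b = sym (+-identityʳ (𝟙 b))
𝟙-∧ false b = refl

𝟙≤1 : ∀ b → 𝟙 b ≤ 1
𝟙≤1 true  = ≤-refl
𝟙≤1 false = z≤n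

∑-cong : ∀ (xs : List A) {f g : A → ℕ} → (∀ x → f x ≡ g x) → ∑ xs f ≡ ∑ xs g
∑-cong []       e = refl
∑-cong (x ∷ xs) e = cong₂ _+_ (e x) (∑-cong xs e)

∑-mono : ∀ (xs : List A) {f g : A → ℕ} → (∀ x → f x ≤ g x) → ∑ xs f ≤ ∑ xs g
∑-mono []       e = z≤n
∑-mono (x ∷ xs) e = +-mono-≤ (e x) (∑-mono xs e)

∑-mono-∈ : ∀ (xs : List A) {f g : A → ℕ} → (∀ {x} → x ∈ xs → f x ≤ g x) → ∑ xs f ≤ ∑ xs g
∑-mono-∈ []       e = z≤n
∑-mono-∈ (x ∷ xs) e = +-mono-≤ (e (here refl)) (∑-mono-∈ xs (e ∘ there))

∑-++ : ∀ (xs ys : List A) (f : A → ℕ) → ∑ (xs ++ ys) f ≡ ∑ xs f + ∑ ys f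
∑-++ xs ys f = trans (cong sum (map-++ f xs ys)) (sum-++ (map f xs) (map f ys))

∑-+ : ∀ (xs : List A) (f g : A → ℕ) → ∑ xs (λ x → f x + g x) ≡ ∑ xs f + ∑ xs g
∑-+ []       f g = refl
∑-+ (x ∷ xs) f g = trans (cong ((f x + g x) +_) (∑-+ xs f g)) (lem (f x) (g x) _ _)
  where
  lem : ∀ a b c d → (a + b) + (c + d) ≡ (a + c) + (b + d)
  lem = solve-∀

∑-*ˡ : ∀ (xs : List A) c (f : A → ℕ) → ∑ xs (λ x → c * f x) ≡ c * ∑ xs f
∑-*ˡ []       c f = sym (*-zeroʳ c)
∑-*ˡ (x ∷ xs) c f = trans (cong (c * f x +_) (∑-*ˡ xs c f)) (sym (*-distribˡ-+ c (f x) _))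

∑-*ʳ : ∀ (xs : List A) c (f : A → ℕ) → ∑ xs (λ x → f x * c) ≡ ∑ xs f * c
∑-*ʳ xs c f = trans (∑-cong xs (λ x → *-comm (f x) c)) (trans (∑-*ˡ xs c f) (*-comm c _))

∑-const : ∀ (xs : List A) c → ∑ xs (λ _ → c) ≡ length xs * c
∑-const []       c = refl
∑-const (x ∷ xs) c = cong (c +_) (∑-const xs c)

∑-swap : ∀ (xs : List A) (ys : List A′) (f : A → A′ → ℕ) →
  ∑ xs (λ x → ∑ ys (f x)) ≡ ∑ ys (λ y → ∑ xs (λ x → f x y))
∑-swap []       ys f = sym (trans (∑-const ys 0) (*-zeroʳ (length ys)))
∑-swap (x ∷ xs) ys f =
  trans (cong (∑ ys (f x) +_) (∑-swap xs ys f)) (sym (∑-+ ys (f x) _))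

∑-map : ∀ (h : A → A′) (xs : List A) (f : A′ → ℕ) → ∑ (map h xs) f ≡ ∑ xs (f ∘ h)
∑-map h []       f = refl
∑-map h (x ∷ xs) f = cong (f (h x) +_) (∑-map h xs f)

∑-filterᵇ : ∀ (p : A → Bool) (xs : List A) (f : A → ℕ) →
  ∑ (filterᵇ p xs) f ≡ ∑ xs (λ x → f x * 𝟙 (p x))
∑-filterᵇ p []       f = refl
∑-filterᵇ p (x ∷ xs) f with p x
... | true  = cong₂ _+_ (sym (*-identityʳ (f x))) (∑-filterᵇ p xs f)
... | false = trans (∑-filterᵇ p xs f) (cong (_+ ∑ xs (λ y → f y * 𝟙 (p y))) (sym (*-zeroʳ (f x))))

∑-<⇒∃ : ∀ (xs : List A) {f g : A → ℕ} → ∑ xs f < ∑ xs g → ∃ λ x → x ∈ xs × f x < g x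
∑-<⇒∃ (x ∷ xs) {f} {g} lt with f x <? g x
... | yes p = x , here refl , p
... | no ¬p with ∑-<⇒∃ xs (+-cancelˡ-< (g x) _ _ (≤-<-trans (+-monoˡ-≤ _ (≮⇒≥ ¬p)) lt))
...   | y , y∈ , q = y , there y∈ , q

#≤length : ∀ (p : A → Bool) (xs : List A) → # p xs ≤ length xs
#≤length p xs = ≤-trans (∑-mono xs (𝟙≤1 ∘ p)) (≤-reflexive (trans (∑-const xs 1) (*-identityʳ _)))

length-filterᵇ : ∀ (p : A → Bool) (xs : List A) → length (filterᵇ p xs) ≡ # p xs
length-filterᵇ p xs = trans (sym (trans (∑-const (filterᵇ p xs) 1) (*-identityʳ _)))
  (trans (∑-filterᵇ p xs (λ _ → 1)) (∑-cong xs (λ x → *-identityˡ _)))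

∑-fiber-≤ : ∀ (xs : List A) (ys : List A′) (P : A → A′ → Bool) →
  (∀ x → # (P x) ys ≤ 1) → ∑ ys (λ y → # (λ x → P x y) xs) ≤ length xs
∑-fiber-≤ xs ys P h = begin
  ∑ ys (λ y → # (λ x → P x y) xs) ≡⟨ ∑-swap xs ys (λ x y → 𝟙 (P x y)) ⟨
  ∑ xs (λ x → # (P x) ys)         ≤⟨ ∑-mono xs h ⟩
  ∑ xs (λ _ → 1)                  ≡⟨ ∑-const xs 1 ⟩
  length xs * 1                   ≡⟨ *-identityʳ _ ⟩
  length xs                       ∎
  where open ≤-Reasoning

-- Union bound, by induction on `Ps`: replacing `C` by `C` minus `P` lowers its count in `U` by at
-- most `# P U`.
∃-avoiding : ∀ (Ps : List (A → Bool)) (C : A → Bool) (U : List A) →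
  ∑ Ps (λ P → # P U) < # C U →
  ∃ λ x → x ∈ U × C x ≡ true × All (λ P → P x ≡ false) Ps
∃-avoiding {A = A} [] C U lt = go U lt
  where
  go : ∀ U → 0 < # C U → ∃ λ x → x ∈ U × C x ≡ true × All {A = A → Bool} (λ P → P x ≡ false) []
  go (x ∷ U) lt with C x in eq
  ... | true  = x , here refl , eq , []
  ... | false with go U lt
  ...   | y , y∈ , c , a = y , there y∈ , c , a
∃-avoiding {A = A} (P ∷ Ps) C U lt with ∃-avoiding Ps (λ x → C x ∧ not (P x)) U lt′
  where
  pw : ∀ a b → 𝟙 a ≤ 𝟙 b + 𝟙 (a ∧ not b)
  pw true  true  = s≤s z≤n
  pw true  false = s≤s z≤n
  pw false b     = z≤n
  lt′ : ∑ Ps (λ P → # P U) < # (λ x → C x ∧ not (P x)) U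
  lt′ = +-cancelˡ-< (# P U) _ _ (<-≤-trans lt (≤-trans (∑-mono U (λ x → pw (C x) (P x)))
          (≤-reflexive (∑-+ U (λ x → 𝟙 (P x)) (λ x → 𝟙 (C x ∧ not (P x)))))))
... | x , x∈ , c , a = x , x∈ , ∧-true₁ c , ∧-false (C x) (P x) c ∷ a
  where
  ∧-true₁ : ∀ {a b} → a ∧ b ≡ true → a ≡ true
  ∧-true₁ {true} _ = refl
  ∧-false : ∀ a b → a ∧ not b ≡ true → b ≡ false
  ∧-false true false _ = refl

-- The difference of the two sides is `(y - x) * (w - z)`, which is `h * k` below.
rearrangement : ∀ {x y z w} → x ≤ y → z ≤ w → x * w + y * z ≤ x * z + y * w
rearrangement {x} {z = z} x≤y z≤w with m≤n⇒∃[o]m+o≡n x≤y | m≤n⇒∃[o]m+o≡n z≤w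
... | h , refl | k , refl = ≤-trans (m≤m+n _ (h * k)) (≤-reflexive (lem x h z k))
  where
  lem : ∀ x h z k → x * (z + k) + (x + h) * z + h * k ≡ x * z + (x + h) * (z + k)
  lem = solve-∀

-- Sum `(f x - r) * (f x ^ s - r ^ s) ≥ 0` over `xs`; `tangent` is this inequality without
-- subtraction. The mixed terms are bounded below by the induction hypothesis and by `h`.
power-mean : ∀ (xs : List A) (f : A → ℕ) r s → length xs * r ≤ ∑ xs f →
  length xs * r ^ s ≤ ∑ xs (λ x → f x ^ s)
power-mean xs f r zero    h = ≤-reflexive (sym (∑-const xs 1))
power-mean xs f r (suc s) h = +-cancelʳ-≤ (length xs * (r * r ^ s)) _ _ (begin
  m * (r * r ^ s) + m * (r * r ^ s)
    ≡⟨ lem m r (r ^ s) ⟩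
  r * (m * r ^ s) + r ^ s * (m * r)
    ≤⟨ +-mono-≤ (*-monoʳ-≤ r (power-mean xs f r s h)) (*-monoʳ-≤ (r ^ s) h) ⟩
  r * ∑ xs (λ x → f x ^ s) + r ^ s * ∑ xs f
    ≡⟨ cong₂ _+_ (∑-*ˡ xs r _) (∑-*ˡ xs (r ^ s) f) ⟨
  ∑ xs (λ x → r * f x ^ s) + ∑ xs (λ x → r ^ s * f x)
    ≡⟨ ∑-+ xs _ _ ⟨
  ∑ xs (λ x → r * f x ^ s + r ^ s * f x)
    ≤⟨ ∑-mono xs (λ x → tangent (f x)) ⟩
  ∑ xs (λ x → f x ^ suc s + r ^ suc s)
    ≡⟨ ∑-+ xs _ _ ⟩
  ∑ xs (λ x → f x ^ suc s) + ∑ xs (λ _ → r ^ suc s)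
    ≡⟨ cong (∑ xs (λ x → f x ^ suc s) +_) (∑-const xs _) ⟩
  ∑ xs (λ x → f x ^ suc s) + m * (r * r ^ s) ∎)
  where
  open ≤-Reasoning
  m = length xs
  lem : ∀ m r q → m * (r * q) + m * (r * q) ≡ r * (m * q) + q * (m * r)
  lem = solve-∀
  tangent : ∀ a → r * a ^ s + r ^ s * a ≤ a * a ^ s + r * r ^ s
  tangent a with ≤-total a r
  ... | inj₁ a≤r = begin
    r * a ^ s + r ^ s * a ≡⟨ +-comm (r * a ^ s) _ ⟩
    r ^ s * a + r * a ^ s ≡⟨ cong (_+ r * a ^ s) (*-comm (r ^ s) a) ⟩
    a * r ^ s + r * a ^ s ≤⟨ rearrangement a≤r (^-monoˡ-≤ s a≤r) ⟩
    a * a ^ s + r * r ^ s ∎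
  ... | inj₂ r≤a = begin
    r * a ^ s + r ^ s * a ≡⟨ cong (r * a ^ s +_) (*-comm (r ^ s) a) ⟩
    r * a ^ s + a * r ^ s ≤⟨ rearrangement r≤a (^-monoˡ-≤ s r≤a) ⟩
    r * r ^ s + a * a ^ s ≡⟨ +-comm (r * r ^ s) _ ⟩
    a * a ^ s + r * r ^ s ∎

-- Divided by `length U ^ k`, this is the expectation of `F` over `k` independent uniform choices
-- from `U`, given the part `xs` chosen before. The accumulator serves the greedy embedding, where
-- `xs` consists of images already fixed.
∑ᵗ : List A → ℕ → (List A → ℕ) → List A → ℕ
∑ᵗ U zero    F xs = F xs
∑ᵗ U (suc k) F xs = ∑ U (λ x → ∑ᵗ U k F (x ∷ xs))

∑ᵗ-cong : ∀ (U : List A) k {F G : List A → ℕ} → (∀ xs → F xs ≡ G xs) → ∀ xs → ∑ᵗ U k F xs ≡ ∑ᵗ U k G xs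
∑ᵗ-cong U zero    e xs = e xs
∑ᵗ-cong U (suc k) e xs = ∑-cong U (λ x → ∑ᵗ-cong U k e (x ∷ xs))

∑ᵗ-mono : ∀ (U : List A) k {F G : List A → ℕ} → (∀ xs → F xs ≤ G xs) → ∀ xs → ∑ᵗ U k F xs ≤ ∑ᵗ U k G xs
∑ᵗ-mono U zero    e xs = e xs
∑ᵗ-mono U (suc k) e xs = ∑-mono U (λ x → ∑ᵗ-mono U k e (x ∷ xs))

∑ᵗ-+ : ∀ (U : List A) k (F G : List A → ℕ) xs →
  ∑ᵗ U k (λ zs → F zs + G zs) xs ≡ ∑ᵗ U k F xs + ∑ᵗ U k G xs
∑ᵗ-+ U zero    F G xs = refl
∑ᵗ-+ U (suc k) F G xs = trans (∑-cong U (λ x → ∑ᵗ-+ U k F G (x ∷ xs))) (∑-+ U _ _)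

∑ᵗ-*ˡ : ∀ (U : List A) k c (F : List A → ℕ) xs → ∑ᵗ U k (λ zs → c * F zs) xs ≡ c * ∑ᵗ U k F xs
∑ᵗ-*ˡ U zero    c F xs = refl
∑ᵗ-*ˡ U (suc k) c F xs = trans (∑-cong U (λ x → ∑ᵗ-*ˡ U k c F (x ∷ xs))) (∑-*ˡ U c _)

∑ᵗ-const : ∀ (U : List A) k c xs → ∑ᵗ U k (λ _ → c) xs ≡ length U ^ k * c
∑ᵗ-const U zero    c xs = sym (+-identityʳ c)
∑ᵗ-const U (suc k) c xs = trans (∑-cong U (λ x → ∑ᵗ-const U k c (x ∷ xs)))
  (trans (∑-const U _) (sym (*-assoc (length U) _ c)))

∑-∑ᵗ-swap : ∀ (xs : List A) (U : List A′) k (F : A → List A′ → ℕ) zs →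
  ∑ xs (λ x → ∑ᵗ U k (F x) zs) ≡ ∑ᵗ U k (λ ys → ∑ xs (λ x → F x ys)) zs
∑-∑ᵗ-swap xs U zero    F zs = refl
∑-∑ᵗ-swap xs U (suc k) F zs = trans (∑-swap xs U _) (∑-cong U (λ y → ∑-∑ᵗ-swap xs U k F (y ∷ zs)))

∑ᵗ-swap : ∀ (U : List A) k (W : List A′) l (F : List A → List A′ → ℕ) xs ys →
  ∑ᵗ U k (λ zs → ∑ᵗ W l (F zs) ys) xs ≡ ∑ᵗ W l (λ ws → ∑ᵗ U k (λ zs → F zs ws) xs) ys
∑ᵗ-swap U zero    W l F xs ys = refl
∑ᵗ-swap U (suc k) W l F xs ys = trans (∑-cong U (λ x → ∑ᵗ-swap U k W l F (x ∷ xs) ys))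
  (∑-∑ᵗ-swap U W l _ ys)

∑ᵗ-<⇒∃ : ∀ (U : List A) k {F G : List A → ℕ} xs → ∑ᵗ U k F xs < ∑ᵗ U k G xs → ∃ λ zs → F zs < G zs
∑ᵗ-<⇒∃ U zero    xs lt = xs , lt
∑ᵗ-<⇒∃ U (suc k) xs lt with ∑-<⇒∃ U lt
... | x , _ , lt′ = ∑ᵗ-<⇒∃ U k (x ∷ xs) lt′

-- Independence: each of the `k` new entries contributes its own factor `# P U`.
∑ᵗ-all : ∀ (P : A → Bool) (U : List A) k xs →
  ∑ᵗ U k (λ zs → 𝟙 (all P zs)) xs ≡ # P U ^ k * 𝟙 (all P xs)
∑ᵗ-all P U zero    xs = sym (+-identityʳ _)
∑ᵗ-all P U (suc k) xs = begin
  ∑ U (λ x → ∑ᵗ U k (λ zs → 𝟙 (all P zs)) (x ∷ xs))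
    ≡⟨ ∑-cong U (λ x → trans (∑ᵗ-all P U k (x ∷ xs)) (trans (cong (# P U ^ k *_) (𝟙-∧ (P x) (all P xs))) (lem (# P U ^ k) (𝟙 (P x)) (𝟙 (all P xs))))) ⟩
  ∑ U (λ x → 𝟙 (P x) * (# P U ^ k * 𝟙 (all P xs)))
    ≡⟨ ∑-*ʳ U _ _ ⟩
  # P U * (# P U ^ k * 𝟙 (all P xs))
    ≡⟨ *-assoc (# P U) (# P U ^ k) _ ⟨
  # P U ^ suc k * 𝟙 (all P xs) ∎
  where
  open ≡-Reasoning
  lem : ∀ a b c → a * (b * c) ≡ b * (a * c)
  lem = solve-∀

-- Moves the restriction on tuples from the range of the sum into the summand. The range
-- `inNbhd J ys` varies with `ys`; once it is replaced by `J`, the sums over samples and over tuples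
-- can be exchanged.
∑ᵗ-filterᵇ : ∀ (P : A → Bool) (J : List A) k (F : List A → ℕ) xs →
  ∑ᵗ (filterᵇ P J) k F xs * 𝟙 (all P xs) ≡ ∑ᵗ J k (λ zs → F zs * 𝟙 (all P zs)) xs
∑ᵗ-filterᵇ P J zero    F xs = refl
∑ᵗ-filterᵇ P J (suc k) F xs = begin
  ∑ (filterᵇ P J) (λ x → ∑ᵗ (filterᵇ P J) k F (x ∷ xs)) * 𝟙 (all P xs)
    ≡⟨ cong (_* 𝟙 (all P xs)) (∑-filterᵇ P J _) ⟩
  ∑ J (λ x → ∑ᵗ (filterᵇ P J) k F (x ∷ xs) * 𝟙 (P x)) * 𝟙 (all P xs)
    ≡⟨ ∑-*ʳ J _ _ ⟨
  ∑ J (λ x → ∑ᵗ (filterᵇ P J) k F (x ∷ xs) * 𝟙 (P x) * 𝟙 (all P xs))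
    ≡⟨ ∑-cong J (λ x → trans (*-assoc (∑ᵗ (filterᵇ P J) k F (x ∷ xs)) _ _)
         (trans (cong (∑ᵗ (filterᵇ P J) k F (x ∷ xs) *_) (sym (𝟙-∧ (P x) (all P xs)))) (∑ᵗ-filterᵇ P J k F (x ∷ xs)))) ⟩
  ∑ J (λ x → ∑ᵗ J k (λ zs → F zs * 𝟙 (all P zs)) (x ∷ xs)) ∎
  where open ≡-Reasoning

-- Dependent random choice

all-true : ∀ (xs : List A) → all (λ _ → true) xs ≡ true
all-true []       = refl
all-true (x ∷ xs) = all-true xs

all-∧ : ∀ (p q : A → Bool) xs → all (λ x → p x ∧ q x) xs ≡ all p xs ∧ all q xs
all-∧ p q []       = refl
all-∧ p q (x ∷ xs) rewrite all-∧ p q xs = lem (p x) (q x) (all p xs) (all q xs)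
  where
  lem : ∀ a b c d → (a ∧ b) ∧ (c ∧ d) ≡ (a ∧ c) ∧ (b ∧ d)
  lem false b c d = refl
  lem true false c d = sym (∧-zeroʳ c)
  lem true true c d = refl

-- A tuple `xs` lies in the common in-neighbourhood of `ys` exactly when `ys` lies in the common
-- out-neighbourhood of `xs`. This turns survival of a tuple into a condition on the sample.
all-swap : ∀ (R : A → A′ → Bool) xs ys →
  all (λ x → all (R x) ys) xs ≡ all (λ y → all (λ x → R x y) xs) ys
all-swap R []       ys = sym (all-true ys)
all-swap R (x ∷ xs) ys = trans (cong (all (R x) ys ∧_) (all-swap R xs ys))
  (sym (all-∧ (R x) (λ y → all (λ z → R z y) xs) ys))

^-distribʳ-* : ∀ n x y → (x * y) ^ n ≡ x ^ n * y ^ n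
^-distribʳ-* zero    x y = refl
^-distribʳ-* (suc n) x y = trans (cong (x * y *_) (^-distribʳ-* n x y)) (lem x y (x ^ n) (y ^ n))
  where
  lem : ∀ p q r t → p * q * (r * t) ≡ p * r * (q * t)
  lem = solve-∀

module _ {V : Set} (T : V → V → Bool) where

  codeg : List V → List V → ℕ
  codeg U xs = # (λ y → all (λ x → T x y) xs) U

  inNbhd : List V → List V → List V
  inNbhd J ys = filterᵇ (λ x → all (T x) ys) J

  poor : List V → ℕ → List V → ℕ
  poor U c xs = 𝟙 (codeg U xs <ᵇ c)

  -- A vertex `x` of `J` survives when all `s` samples fall among its out-neighbours, which happens
  -- for `# (T x) U ^ s` samples.
  ∑-inNbhd : ∀ J U s →
    ∑ᵗ U s (λ ys → length (inNbhd J ys)) [] ≡ ∑ J (λ x → # (T x) U ^ s)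
  ∑-inNbhd J U s = begin
    ∑ᵗ U s (λ ys → length (inNbhd J ys)) []
      ≡⟨ ∑ᵗ-cong U s (λ ys → length-filterᵇ (λ x → all (T x) ys) J) [] ⟩
    ∑ᵗ U s (λ ys → ∑ J (λ x → 𝟙 (all (T x) ys))) []
      ≡⟨ ∑-∑ᵗ-swap J U s _ [] ⟨
    ∑ J (λ x → ∑ᵗ U s (λ ys → 𝟙 (all (T x) ys)) [])
      ≡⟨ ∑-cong J (λ x → trans (∑ᵗ-all (T x) U s []) (*-identityʳ _)) ⟩
    ∑ J (λ x → # (T x) U ^ s) ∎
    where open ≡-Reasoning

  -- A poor tuple survives only when all `s` samples fall among its fewer than `c` common
  -- out-neighbours, hence for at most `c ^ s` samples.
  ∑-poor : ∀ J U c d s →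
    ∑ᵗ U s (λ ys → ∑ᵗ (inNbhd J ys) d (poor U c) []) [] ≤ length J ^ d * c ^ s
  ∑-poor J U c d s = begin
    ∑ᵗ U s (λ ys → ∑ᵗ (inNbhd J ys) d (poor U c) []) []
      ≡⟨ ∑ᵗ-cong U s (λ ys → trans (sym (*-identityʳ _)) (∑ᵗ-filterᵇ (λ x → all (T x) ys) J d (poor U c) [])) [] ⟩
    ∑ᵗ U s (λ ys → ∑ᵗ J d (λ xs → poor U c xs * 𝟙 (all (λ x → all (T x) ys) xs)) []) []
      ≡⟨ ∑ᵗ-swap U s J d _ [] [] ⟩
    ∑ᵗ J d (λ xs → ∑ᵗ U s (λ ys → poor U c xs * 𝟙 (all (λ x → all (T x) ys) xs)) []) []
      ≤⟨ ∑ᵗ-mono J d bound [] ⟩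
    ∑ᵗ J d (λ _ → c ^ s) []
      ≡⟨ ∑ᵗ-const J d (c ^ s) [] ⟩
    length J ^ d * c ^ s ∎
    where
    open ≤-Reasoning
    poor-* : ∀ xs → poor U c xs * codeg U xs ^ s ≤ c ^ s
    poor-* xs with codeg U xs <ᵇ c in eq
    ... | true  = ≤-trans (≤-reflexive (*-identityˡ _)) (^-monoˡ-≤ s (<⇒≤ (<ᵇ⇒< (codeg U xs) c (T⁺ eq))))
    ... | false = z≤n
    bound : ∀ xs → ∑ᵗ U s (λ ys → poor U c xs * 𝟙 (all (λ x → all (T x) ys) xs)) [] ≤ c ^ s
    bound xs = begin
      ∑ᵗ U s (λ ys → poor U c xs * 𝟙 (all (λ x → all (T x) ys) xs)) []
        ≡⟨ ∑ᵗ-*ˡ U s (poor U c xs) _ [] ⟩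
      poor U c xs * ∑ᵗ U s (λ ys → 𝟙 (all (λ x → all (T x) ys) xs)) []
        ≡⟨ cong (poor U c xs *_) (∑ᵗ-cong U s (λ ys → cong 𝟙 (all-swap T xs ys)) []) ⟩
      poor U c xs * ∑ᵗ U s (λ ys → 𝟙 (all (λ y → all (λ x → T x y) xs) ys)) []
        ≡⟨ cong (poor U c xs *_) (trans (∑ᵗ-all _ U s []) (*-identityʳ _)) ⟩
      poor U c xs * codeg U xs ^ s
        ≤⟨ poor-* xs ⟩
      c ^ s ∎

  -- For a random sample `ys`, density `a / b` and the power mean give the size `X` an expectation
  -- of at least `2 * X₀`, while by `∑-poor` and the last hypothesis `m * D ^ d` times the expected
  -- number `Y` of poor tuples stays below `X₀ * v ^ d`. A single sample then serves both purposes.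
  dependent-random-choice : ∀ (J U : List V) (c X₀ v D d s a b : ℕ) .{{_ : NonZero b}} →
    length J * (a * length U) ≤ b * ∑ J (λ x → # (T x) U) →
    2 * X₀ * b ^ s ≤ length J * a ^ s →
    length J ^ suc d * c ^ s * D ^ d < length U ^ s * X₀ * v ^ d →
    ∃ λ ys → X₀ < length (inNbhd J ys) ×
             ∑ᵗ (inNbhd J ys) d (poor U c) [] * D ^ d < v ^ d
  dependent-random-choice J U c X₀ v D d s a b dense large few =
    proj₁ good , X>X₀ , Y<
    where
    m = length J
    u = length U
    X Y : List V → ℕ
    X ys = length (inNbhd J ys)
    Y ys = ∑ᵗ (inNbhd J ys) d (poor U c) []

    many : 2 * X₀ * u ^ s ≤ ∑ᵗ U s X []
    many = *-cancelˡ-≤ (b ^ s) {{m^n≢0 b s}} (begin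
      b ^ s * (2 * X₀ * u ^ s)      ≡⟨ lem₁ (b ^ s) (2 * X₀) (u ^ s) ⟩
      (2 * X₀ * b ^ s) * u ^ s      ≤⟨ *-monoˡ-≤ (u ^ s) large ⟩
      m * a ^ s * u ^ s             ≡⟨ *-assoc m (a ^ s) (u ^ s) ⟩
      m * (a ^ s * u ^ s)           ≡⟨ cong (m *_) (^-distribʳ-* s a u) ⟨
      m * (a * u) ^ s
        ≤⟨ power-mean J (λ x → b * # (T x) U) (a * u) s (≤-trans dense (≤-reflexive (sym (∑-*ˡ J b _)))) ⟩
      ∑ J (λ x → (b * # (T x) U) ^ s)
        ≡⟨ ∑-cong J (λ x → ^-distribʳ-* s b (# (T x) U)) ⟩
      ∑ J (λ x → b ^ s * # (T x) U ^ s)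
        ≡⟨ ∑-*ˡ J (b ^ s) _ ⟩
      b ^ s * ∑ J (λ x → # (T x) U ^ s)
        ≡⟨ cong (b ^ s *_) (∑-inNbhd J U s) ⟨
      b ^ s * ∑ᵗ U s X [] ∎)
      where
      open ≤-Reasoning
      lem₁ : ∀ p q r → p * (q * r) ≡ (q * p) * r
      lem₁ = solve-∀

    -- As X ≤ m, the strict inequality forces both X₀ < X and Y * D ^ d < v ^ d.
    good : ∃ λ ys → m * D ^ d * Y ys + v ^ d * X₀ < v ^ d * X ys
    good = ∑ᵗ-<⇒∃ U s [] (begin-strict
      ∑ᵗ U s (λ ys → m * D ^ d * Y ys + v ^ d * X₀) []
        ≡⟨ trans (∑ᵗ-+ U s _ _ []) (cong₂ _+_ (∑ᵗ-*ˡ U s (m * D ^ d) Y []) (∑ᵗ-const U s _ [])) ⟩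
      m * D ^ d * ∑ᵗ U s Y [] + u ^ s * (v ^ d * X₀)
        ≤⟨ +-monoˡ-≤ _ (*-monoʳ-≤ (m * D ^ d) (∑-poor J U c d s)) ⟩
      m * D ^ d * (m ^ d * c ^ s) + u ^ s * (v ^ d * X₀)
        ≡⟨ cong₂ _+_ (lem₁ m (D ^ d) (m ^ d) (c ^ s)) (lem₂ (u ^ s) (v ^ d) X₀) ⟩
      m * m ^ d * c ^ s * D ^ d + u ^ s * X₀ * v ^ d
        <⟨ +-monoˡ-< _ few ⟩
      u ^ s * X₀ * v ^ d + u ^ s * X₀ * v ^ d
        ≡⟨ lem₃ (u ^ s) X₀ (v ^ d) ⟩
      v ^ d * (2 * X₀ * u ^ s)
        ≤⟨ *-monoʳ-≤ (v ^ d) many ⟩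
      v ^ d * ∑ᵗ U s X []
        ≡⟨ ∑ᵗ-*ˡ U s (v ^ d) X [] ⟨
      ∑ᵗ U s (λ ys → v ^ d * X ys) [] ∎)
      where
      open ≤-Reasoning
      lem₁ : ∀ p q r t → p * q * (r * t) ≡ p * r * t * q
      lem₁ = solve-∀
      lem₂ : ∀ p q r → p * (q * r) ≡ p * r * q
      lem₂ = solve-∀
      lem₃ : ∀ p q r → p * q * r + p * q * r ≡ r * (2 * q * p)
      lem₃ = solve-∀

    ys = proj₁ good

    X>X₀ : X₀ < X ys
    X>X₀ = *-cancelˡ-< (v ^ d) _ _ (≤-<-trans (m≤n+m _ _) (proj₂ good))

    Y< : Y ys * D ^ d < v ^ d
    Y< = *-cancelʳ-< m _ _ (begin-strict
      Y ys * D ^ d * m          ≡⟨ lem (Y ys) (D ^ d) m ⟩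
      m * D ^ d * Y ys          ≤⟨ m≤m+n _ _ ⟩
      m * D ^ d * Y ys + v ^ d * X₀ <⟨ proj₂ good ⟩
      v ^ d * X ys
        ≤⟨ *-monoʳ-≤ (v ^ d) (≤-trans (≤-reflexive (length-filterᵇ _ J)) (#≤length _ J)) ⟩
      v ^ d * m ∎)
      where
      open ≤-Reasoning
      lem : ∀ p q r → p * q * r ≡ r * q * p
      lem = solve-∀

-- Greedy embedding of one level

all⁻ : ∀ (p : A → Bool) {xs x} → all p xs ≡ true → x ∈ xs → p x ≡ true
all⁻ p {y ∷ _} e (here refl) with p y
... | true = refl
all⁻ p {y ∷ _} e (there x∈) with p y
... | true = all⁻ p e x∈

all⁺ : ∀ (p : A → Bool) xs → (∀ {x} → x ∈ xs → p x ≡ true) → all p xs ≡ true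
all⁺ p []       h = refl
all⁺ p (x ∷ xs) h rewrite h (here refl) = all⁺ p xs (h ∘ there)

𝟙-mono : ∀ {a b} → (a ≡ true → b ≡ true) → 𝟙 a ≤ 𝟙 b
𝟙-mono {true}  h rewrite h refl = ≤-refl
𝟙-mono {false} h = z≤n

∑ᵗ-⊆ : ∀ (U : List A) k {F : List A → ℕ} → (∀ {xs ys} → xs ⊆ ys → F xs ≤ F ys) →
  ∀ {xs ys} → xs ⊆ ys → ∑ᵗ U k F xs ≤ ∑ᵗ U k F ys
∑ᵗ-⊆ U zero    m s = m s
∑ᵗ-⊆ U (suc k) m s = ∑-mono U (λ x → ∑ᵗ-⊆ U k m (∷⁺ʳ x s))

#-≟≤1 : (_≟_ : ∀ (x y : A) → Dec (x ≡ y)) → ∀ z {U} → Unique U → # (λ x → does (x ≟ z)) U ≤ 1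
#-≟≤1 _≟_ z []       = z≤n
#-≟≤1 {A = A} _≟_ z (_∷_ {x} {U} x∉ un) with x ≟ z
... | no  _    = #-≟≤1 _≟_ z un
... | yes refl = s≤s (≤-reflexive (none x∉))
  where
  none : ∀ {U} → All (λ y → x ≢ y) U → # (λ y → does (y ≟ x)) U ≡ 0
  none []       = refl
  none (_∷_ {y} ne a) rewrite dec-false (y ≟ x) (ne ∘ sym) = none a

module _ {V : Set} (T : V → V → Bool) where

  -- Enlarging a tuple can only lose common out-neighbours.
  poor-⊆ : ∀ U c {xs ys} → xs ⊆ ys → poor T U c xs ≤ poor T U c ys
  poor-⊆ U c {xs} {ys} s = 𝟙-mono (λ e → T⁻ (<⇒<ᵇ (≤-<-trans
    (∑-mono U (λ y → 𝟙-mono (λ a → all⁺ (λ x → T x y) xs (all⁻ (λ x → T x y) a ∘ s))))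
    (<ᵇ⇒< (codeg T U xs) c (T⁺ e)))))

  module Greedy {n} (E : Digraph n) (_≟_ : ∀ (x y : V) → Dec (x ≡ y))
    (U : List V) (U-unique : Unique U) (U′ : List V) (c v D : ℕ) .{{_ : NonZero D}}
    (outDeg≤ : ∀ x → # (E x) (allFin n) ≤ D) where

    -- Fewer than (v / D) ^ k of the extensions of xs by k vertices of U are poor.
    Promising : ℕ → List V → Set
    Promising k xs = ∑ᵗ U k (poor T U′ c) xs * D ^ k < v ^ k

    -- A poor tuple stays poor when extended, so each poor extension by `k` vertices accounts for
    -- `length U ≥ v` poor extensions by `suc k`. This handles vertices with fewer than `d`
    -- in-neighbours in the level.
    Promising-pred : v ≤ length U → ∀ k xs → Promising (suc k) xs → Promising k xs
    Promising-pred v≤ k xs h = *-cancelˡ-< v _ _ (begin-strict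
      v * (t * D ^ k)            ≤⟨ *-monoˡ-≤ (t * D ^ k) v≤ ⟩
      length U * (t * D ^ k)     ≡⟨ *-assoc (length U) t (D ^ k) ⟨
      length U * t * D ^ k       ≡⟨ cong (_* D ^ k) (∑-const U t) ⟨
      ∑ U (λ _ → t) * D ^ k      ≤⟨ *-mono-≤ (∑-mono U (λ x → ∑ᵗ-⊆ U k (poor-⊆ U′ c) there)) (m≤n*m (D ^ k) D) ⟩
      ∑ᵗ U (suc k) (poor T U′ c) xs * D ^ suc k <⟨ h ⟩
      v ^ suc k                  ∎)
      where
      open ≤-Reasoning
      t = ∑ᵗ U k (poor T U′ c) xs

    Promising-≤ : v ≤ length U → ∀ {k l} xs → k ≤ l → Promising l xs → Promising k xs
    Promising-≤ v≤ {k} xs k≤l h with m≤n⇒∃[o]m+o≡n k≤l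
    ... | o , refl = go o h
      where
      go : ∀ o → Promising (k + o) xs → Promising k xs
      go zero    p = subst (λ l → Promising l xs) (+-identityʳ k) p
      go (suc o) p = go o (Promising-pred v≤ (k + o) xs (subst (λ l → Promising l xs) (+-suc k o) p))

    -- The Boolean negation of `Promising k (y ∷ xs)`. By Markov's inequality fewer than `v / D`
    -- vertices of `U` spoil a promising `xs`; the factor `D ^ k` in `Promising` ensures that the at
    -- most `D` out-neighbours of a vertex together rule out at most `v` choices.
    spoils : ℕ → List V → V → Bool
    spoils k xs y = v ^ k ≤ᵇ ∑ᵗ U k (poor T U′ c) (y ∷ xs) * D ^ k

    #-spoils : ∀ k xs → Promising (suc k) xs → D * # (spoils k xs) U < v
    #-spoils k xs h = *-cancelʳ-< (v ^ k) _ _ (begin-strict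
      D * # (spoils k xs) U * v ^ k
        ≡⟨ *-assoc D _ (v ^ k) ⟩
      D * (# (spoils k xs) U * v ^ k)
        ≡⟨ cong (D *_) (∑-*ʳ U (v ^ k) _) ⟨
      D * ∑ U (λ y → 𝟙 (spoils k xs y) * v ^ k)
        ≤⟨ *-monoʳ-≤ D (∑-mono U markov) ⟩
      D * ∑ U (λ y → ∑ᵗ U k (poor T U′ c) (y ∷ xs) * D ^ k)
        ≡⟨ cong (D *_) (∑-*ʳ U (D ^ k) _) ⟩
      D * (∑ᵗ U (suc k) (poor T U′ c) xs * D ^ k)
        ≡⟨ lem D (∑ᵗ U (suc k) (poor T U′ c) xs) (D ^ k) ⟩
      ∑ᵗ U (suc k) (poor T U′ c) xs * D ^ suc k
        <⟨ h ⟩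
      v ^ suc k ∎)
      where
      open ≤-Reasoning
      lem : ∀ p q r → p * (q * r) ≡ q * (p * r)
      lem = solve-∀
      markov : ∀ y → 𝟙 (spoils k xs y) * v ^ k ≤ ∑ᵗ U k (poor T U′ c) (y ∷ xs) * D ^ k
      markov y with spoils k xs y in eq
      ... | true  = ≤-trans (≤-reflexive (*-identityˡ _)) (≤ᵇ⇒≤ _ _ (T⁺ eq))
      ... | false = z≤n

    -- In `greedy`, `xs w` holds the images of the in-neighbours of `w` placed so far. As `zs w`
    -- contains the images of all of them, any common out-neighbour of `zs w` respects the edges
    -- from this level into `w`.
    record Result (C : Fin n → V → Bool) (rem : List (Fin n)) (xs : Fin n → List V) (used : List V) : Set where
      field
        f         : Fin n → V
        zs        : Fin n → List V
        f-∈       : ∀ {x} → x ∈ rem → f x ∈ U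
        f-C       : ∀ {x} → x ∈ rem → C x (f x) ≡ true
        f-∉       : ∀ {x} → x ∈ rem → f x ∉ used
        f-inj     : ∀ {x y} → x ∈ rem → y ∈ rem → f x ≡ f y → x ≡ y
        zs-rich   : ∀ w → c ≤ codeg T U′ (zs w)
        xs⊆zs     : ∀ w → xs w ⊆ zs w
        f-zs      : ∀ {x} w → x ∈ rem → E x w ≡ true → f x ∈ zs w

    -- Of the at least `2 * v` candidates for a vertex, at most `v` spoil the tuple of one of its
    -- out-neighbours and fewer than `v` are used. `x₀` is a default value outside `rem`.
    greedy : V → (C : Fin n → V → Bool) → ∀ rem xs used → Unique rem →
      (∀ {x} → x ∈ rem → 2 * v ≤ # (C x) U) →
      length used + length rem ≤ v →
      (∀ w → Promising (# (λ u → E u w) rem) (xs w)) →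
      Result C rem xs used
    greedy x₀ C [] xs used un cand len prom = record
      { f = λ _ → x₀ ; zs = xs ; f-∈ = λ () ; f-C = λ () ; f-∉ = λ () ; f-inj = λ ()
      ; zs-rich = λ w → rich w (prom w)
      ; xs⊆zs = λ w z∈ → z∈ ; f-zs = λ w () }
      where
      rich : ∀ w → Promising 0 (xs w) → c ≤ codeg T U′ (xs w)
      -- `Promising 0` bounds the indicator of poverty strictly by 1, so it vanishes.
      rich w p = ≮⇒≥ λ lt → <-irrefl refl (≤-<-trans (≤-reflexive (sym (trans (*-identityʳ _) (cong 𝟙 (T⁻ (<⇒<ᵇ lt)))))) p)
    greedy x₀ C (x ∷ rem) xs used (x∉rem ∷ un) cand len prom
      with ∃-avoiding (map bad outs ++ map taken used) (C x) U few
      where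
      outs = filterᵇ (E x) (allFin n)
      bad : Fin n → V → Bool
      bad w = spoils (# (λ u → E u w) rem) (xs w)
      taken : V → V → Bool
      taken z y = does (y ≟ z)
      ∑-bad : ∑ outs (λ w → # (bad w) U) ≤ v
      ∑-bad = *-cancelˡ-≤ D (begin
        D * ∑ outs (λ w → # (bad w) U)                       ≡⟨ ∑-*ˡ outs D _ ⟨
        ∑ outs (λ w → D * # (bad w) U)                       ≡⟨ ∑-filterᵇ (E x) (allFin n) _ ⟩
        ∑ (allFin n) (λ w → D * # (bad w) U * 𝟙 (E x w))     ≤⟨ ∑-mono (allFin n) each ⟩
        ∑ (allFin n) (λ w → v * 𝟙 (E x w))                   ≡⟨ ∑-*ˡ (allFin n) v _ ⟩
        v * # (E x) (allFin n)                               ≤⟨ *-monoʳ-≤ v (outDeg≤ x) ⟩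
        v * D                                                ≡⟨ *-comm v D ⟩
        D * v                                                ∎)
        where
        open ≤-Reasoning
        each : ∀ w → D * # (bad w) U * 𝟙 (E x w) ≤ v * 𝟙 (E x w)
        each w with E x w | prom w
        ... | true  | p = *-monoˡ-≤ 1 (<⇒≤ (#-spoils (# (λ u → E u w) rem) (xs w) p))
        ... | false | p = ≤-reflexive (trans (*-zeroʳ (D * # (bad w) U)) (sym (*-zeroʳ v)))
      few : ∑ (map bad outs ++ map taken used) (λ P → # P U) < # (C x) U
      few = begin-strict
        ∑ (map bad outs ++ map taken used) (λ P → # P U)
          ≡⟨ trans (∑-++ (map bad outs) _ _) (cong₂ _+_ (∑-map bad outs _) (∑-map taken used _)) ⟩
        ∑ outs (λ w → # (bad w) U) + ∑ used (λ z → # (taken z) U)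
          ≤⟨ +-mono-≤ ∑-bad (∑-mono used (λ z → #-≟≤1 _≟_ z U-unique)) ⟩
        v + ∑ used (λ _ → 1)
          ≡⟨ cong (v +_) (trans (∑-const used 1) (*-identityʳ _)) ⟩
        v + length used
          -- Strict because `x` itself is still counted in `len`.
          <⟨ +-monoʳ-< v (<-≤-trans (≤-trans (≤-reflexive (+-comm 1 _)) (+-monoʳ-≤ (length used) (s≤s z≤n))) len) ⟩
        v + v
          ≡⟨ cong (v +_) (+-identityʳ v) ⟨
        2 * v
          ≤⟨ cand (here refl) ⟩
        # (C x) U ∎
        where open ≤-Reasoning
    ... | y , y∈ , Cy , avoid = record
      { f = f′ ; zs = zs r
      ; f-∈ = f′-∈ ; f-C = f′-C ; f-∉ = f′-∉ ; f-inj = f′-inj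
      ; zs-rich = zs-rich r
      ; xs⊆zs = λ w z∈ → xs⊆zs r w (xs⊆xs′ w z∈)
      ; f-zs = f′-zs }
      where
      open Result
      xs′ : Fin n → List V
      xs′ w = if E x w then y ∷ xs w else xs w
      xs⊆xs′ : ∀ w → xs w ⊆ xs′ w
      xs⊆xs′ w z∈ with E x w
      ... | true  = there z∈
      ... | false = z∈
      y∈xs′ : ∀ w → E x w ≡ true → y ∈ xs′ w
      y∈xs′ w e rewrite e = here refl
      -- An edge from `x` to `w` adds `y` to the tuple of `w` and lowers its number of pending
      -- in-neighbours by one; `y` was chosen not to spoil that tuple.
      prom′ : ∀ w → Promising (# (λ u → E u w) rem) (xs′ w)
      prom′ w with E x w in eq | prom w
      ... | false | p = p
      ... | true  | p = ≰⇒> λ le → false≢true (trans (sym notBad) (T⁻ (≤⇒≤ᵇ le)))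
        where
        false≢true : false ≢ true
        false≢true ()
        notBad : spoils (# (λ u → E u w) rem) (xs w) y ≡ false
        notBad = lookup avoid (∈-++⁺ˡ (∈-map⁺ _ (∈-filter⁺ _ (∈-allFin w) (T⁺ eq))))
      y∉used : y ∉ used
      y∉used y∈used with lookup avoid (∈-++⁺ʳ (map _ _) (∈-map⁺ (λ z y → does (y ≟ z)) y∈used))
      ... | e with trans (sym e) (dec-true (y ≟ y) refl)
      ...   | ()
      r : Result C rem xs′ (y ∷ used)
      r = greedy x₀ C rem xs′ (y ∷ used) un (cand ∘ there) (≤-trans (≤-reflexive (sym (+-suc _ _))) len) prom′
      f′ : Fin n → V
      f′ u = if does (u Fin.≟ x) then y else f r u
      f′-x : f′ x ≡ y
      f′-x rewrite dec-true (x Fin.≟ x) refl = refl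
      f′-rem : ∀ {u} → u ∈ rem → f′ u ≡ f r u
      f′-rem {u} u∈ rewrite dec-false (u Fin.≟ x) (λ e → lookup x∉rem u∈ (sym e)) = refl
      f′-∈ : ∀ {u} → u ∈ x ∷ rem → f′ u ∈ U
      f′-∈ (here refl) = subst (_∈ U) (sym f′-x) y∈
      f′-∈ (there u∈)  = subst (_∈ U) (sym (f′-rem u∈)) (f-∈ r u∈)
      f′-C : ∀ {u} → u ∈ x ∷ rem → C u (f′ u) ≡ true
      f′-C (here refl) = trans (cong (C x) f′-x) Cy
      f′-C (there u∈)  = trans (cong (C _) (f′-rem u∈)) (f-C r u∈)
      f′-∉ : ∀ {u} → u ∈ x ∷ rem → f′ u ∉ used
      f′-∉ (here refl) h = y∉used (subst (_∈ used) f′-x h)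
      f′-∉ (there u∈)  h = f-∉ r u∈ (there (subst (_∈ used) (f′-rem u∈) h))
      f≢y : ∀ {u} → u ∈ rem → f r u ≢ y
      f≢y u∈ e = f-∉ r u∈ (here e)
      f′-inj : ∀ {u w} → u ∈ x ∷ rem → w ∈ x ∷ rem → f′ u ≡ f′ w → u ≡ w
      f′-inj (here refl) (here refl) e = refl
      f′-inj (here refl) (there w∈)  e = ⊥-elim (f≢y w∈ (trans (sym (f′-rem w∈)) (trans (sym e) f′-x)))
      f′-inj (there u∈)  (here refl) e = ⊥-elim (f≢y u∈ (trans (sym (f′-rem u∈)) (trans e f′-x)))
      f′-inj (there u∈)  (there w∈)  e = f-inj r u∈ w∈ (trans (sym (f′-rem u∈)) (trans e (f′-rem w∈)))
      f′-zs : ∀ {u} w → u ∈ x ∷ rem → E u w ≡ true → f′ u ∈ zs r w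
      f′-zs w (here refl) e = subst (_∈ zs r w) (sym f′-x) (xs⊆zs r w (y∈xs′ w e))
      f′-zs w (there u∈)  e = subst (_∈ zs r w) (sym (f′-rem u∈)) (f-zs r w u∈ e)

  -- Gluing the embeddings of consecutive levels

  module Layered {n} (E : Digraph n) (_≟V_ : ∀ (x y : V) → Dec (x ≡ y)) (lev : Fin n → ℕ)
    (lev-suc : ∀ u w → E u w ≡ true → lev w ≡ suc (lev u))
    (d D : ℕ) .{{_ : NonZero D}}
    (inDeg≤ : ∀ w → # (λ u → E u w) (allFin n) ≤ d)
    (outDeg≤ : ∀ u → # (E u) (allFin n) ≤ D) where

    layer : ℕ → List (Fin n)
    layer i = filterᵇ (λ u → i ≡ᵇ lev u) (allFin n)

    -- The extra 1 keeps the windows of empty levels nonempty; `compress` bounds what it costs.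
    size : ℕ → ℕ
    size i = suc (length (layer i))

    record Embedding (i : ℕ) (C : Fin n → V → Bool) (S : List V) : Set where
      field
        f      : Fin n → V
        f-∈    : ∀ {x} → i ≤ lev x → f x ∈ S
        f-C    : ∀ {x} → lev x ≡ i → C x (f x) ≡ true
        f-inj  : ∀ {x y} → i ≤ lev x → i ≤ lev y → f x ≡ f y → x ≡ y
        f-hom  : ∀ {x y} → i ≤ lev x → E x y ≡ true → T (f x) (f y) ≡ true

    -- Quantified over `C` because the candidate sets of level `i` are common out-neighbourhoods of
    -- images of the level before, which are unknown when `U` is built.
    Ready : ℕ → List V → List V → Set
    Ready i U S = ∀ C → (∀ {x} → lev x ≡ i → 2 * size i ≤ # (C x) U) → Embedding i C S

    -- Placing level `i` greedily into `U` leaves each `w` of the next level a tuple with at least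
    -- `2 * size (suc i)` common out-neighbours in `U′`; these are the candidates handed to
    -- `Ready (suc i)`. Disjointness of `U` and `S′` makes the combined map injective.
    ready-step : ∀ i {U U′ S S′} → Unique U → U ⊆ S → S′ ⊆ S → (∀ {x} → x ∈ U → x ∉ S′) →
      V → size i ≤ length U →
      ∑ᵗ U d (poor T U′ (2 * size (suc i))) [] * D ^ d < size i ^ d →
      Ready (suc i) U′ S′ → Ready i U S
    ready-step i {U} {U′} {S} {S′} un U⊆S S′⊆S disj x₀ size≤ few ready C cand = record
      { f = h ; f-∈ = h-∈ ; f-C = h-C ; f-inj = h-inj ; f-hom = h-hom }
      where
      open Greedy E _≟V_ U un U′ (2 * size (suc i)) (size i) D outDeg≤
      ∈-layer : ∀ {x} → lev x ≡ i → x ∈ layer i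
      ∈-layer {x} e = ∈-filter⁺ _ (∈-allFin x) (≡⇒≡ᵇ i (lev x) (sym e))
      layer-∈ : ∀ {x} → x ∈ layer i → lev x ≡ i
      layer-∈ {x} x∈ = sym (≡ᵇ⇒≡ i (lev x) (proj₂ (∈-filter⁻ (λ _ → T? _) {xs = allFin n} x∈)))
      inDeg-layer : ∀ w → # (λ u → E u w) (layer i) ≤ d
      inDeg-layer w = ≤-trans (≤-reflexive (∑-filterᵇ _ (allFin n) _))
        (≤-trans (∑-mono (allFin n) (λ u → ≤-trans (*-monoʳ-≤ (𝟙 (E u w)) (𝟙≤1 (i ≡ᵇ lev u))) (≤-reflexive (*-identityʳ _)))) (inDeg≤ w))
      layer-unique : Unique (layer i)
      layer-unique = filter⁺ _ (allFin⁺ n)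
      module G = Result (greedy x₀ C (layer i) (λ _ → []) [] layer-unique (cand ∘ layer-∈) (n≤1+n _)
        (λ w → Promising-≤ size≤ [] (inDeg-layer w) few))
      module F = Embedding (ready (λ w y → all (λ x → T x y) (G.zs w)) (λ {w} _ → G.zs-rich w))
      h : Fin n → V
      h x = if does (lev x ≟ i) then G.f x else F.f x
      h-≡ : ∀ {x} → lev x ≡ i → h x ≡ G.f x
      h-≡ {x} e rewrite dec-true (lev x ≟ i) e = refl
      h-> : ∀ {x} → i < lev x → h x ≡ F.f x
      h-> {x} lt rewrite dec-false (lev x ≟ i) (>⇒≢ lt) = refl
      h-∈ : ∀ {x} → i ≤ lev x → h x ∈ S
      h-∈ {x} le with m≤n⇒m<n∨m≡n le
      ... | inj₁ lt = subst (_∈ S) (sym (h-> lt)) (S′⊆S (F.f-∈ lt))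
      ... | inj₂ eq = subst (_∈ S) (sym (h-≡ (sym eq))) (U⊆S (G.f-∈ (∈-layer (sym eq))))
      h-C : ∀ {x} → lev x ≡ i → C x (h x) ≡ true
      h-C e = trans (cong (C _) (h-≡ e)) (G.f-C (∈-layer e))
      clash : ∀ {x y} → i ≡ lev x → i < lev y → h x ≢ h y
      clash ex lt e = disj (G.f-∈ (∈-layer (sym ex)))
        (subst (_∈ S′) (trans (sym (h-> lt)) (trans (sym e) (h-≡ (sym ex)))) (F.f-∈ lt))
      h-inj : ∀ {x y} → i ≤ lev x → i ≤ lev y → h x ≡ h y → x ≡ y
      h-inj lx ly e with m≤n⇒m<n∨m≡n lx | m≤n⇒m<n∨m≡n ly
      ... | inj₁ x> | inj₁ y> = F.f-inj x> y> (trans (sym (h-> x>)) (trans e (h-> y>)))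
      ... | inj₁ x> | inj₂ y≡ = ⊥-elim (clash y≡ x> (sym e))
      ... | inj₂ x≡ | inj₁ y> = ⊥-elim (clash x≡ y> e)
      ... | inj₂ x≡ | inj₂ y≡ = G.f-inj (∈-layer (sym x≡)) (∈-layer (sym y≡))
              (trans (sym (h-≡ (sym x≡))) (trans e (h-≡ (sym y≡))))
      h-hom : ∀ {x y} → i ≤ lev x → E x y ≡ true → T (h x) (h y) ≡ true
      h-hom {x} {y} lx e with m≤n⇒m<n∨m≡n lx
      ... | inj₁ x> = trans (cong₂ T (h-> x>) (h-> (<-trans x> (subst (lev x <_) (sym (lev-suc x y e)) ≤-refl)))) (F.f-hom x> e)
      ... | inj₂ refl = trans (cong₂ T (h-≡ refl) (h-> (≤-reflexive (sym ly))))
              (all⁻ (λ z → T z (F.f y)) (F.f-C ly) (G.f-zs y (∈-layer refl) e))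
        where
        ly = lev-suc x y e

-- Median orders

Unique-resp-↭ : ∀ {xs ys : List A} → xs ↭ ys → Unique xs → Unique ys
Unique-resp-↭ {A} p = Perm.Unique-resp-↭ (setoid A) (↭⇒↭ₛ p)

Unique-++⁻ʳ : ∀ (xs : List A) {ys} → Unique (xs ++ ys) → Unique ys
Unique-++⁻ʳ []       u       = u
Unique-++⁻ʳ (_ ∷ xs) (_ ∷ u) = Unique-++⁻ʳ xs u

Unique-++⁻ˡ : ∀ (xs : List A) {ys} → Unique (xs ++ ys) → Unique xs
Unique-++⁻ˡ []       u        = []
Unique-++⁻ˡ (_ ∷ xs) (x∉ ∷ u) = ++⁻ˡ xs x∉ ∷ Unique-++⁻ˡ xs u

∉-++ : ∀ (P : List A) {Q x} → Unique (P ++ Q) → x ∈ P → x ∉ Q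
∉-++ (z ∷ P) (z∉ ∷ un) (here refl) x∈Q = lookup z∉ (∈-++⁺ʳ P x∈Q) refl
∉-++ (z ∷ P) (z∉ ∷ un) (there x∈P) x∈Q = ∉-++ P un x∈P x∈Q

-- `R` and `S` stand for a property and its failure. A failure must come with its location, because
-- `improve` acts there.
search-suffixes : (R S : List A → Set) → (∀ xs → R xs ⊎ S xs) → ∀ l →
  (∀ xs ys → l ≡ xs ++ ys → R ys) ⊎ ∃₂ λ xs ys → l ≡ xs ++ ys × S ys
search-suffixes R S dec l with dec l
... | inj₂ s = inj₂ ([] , l , refl , s)
search-suffixes R S dec [] | inj₁ r = inj₁ λ { [] .[] refl → r }
search-suffixes R S dec (x ∷ l) | inj₁ r with search-suffixes R S dec l
... | inj₂ (xs , ys , e , s) = inj₂ (x ∷ xs , ys , cong (x ∷_) e , s)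
... | inj₁ h = inj₁ λ { [] ._ refl → r ; (_ ∷ xs) ys refl → h xs ys refl }

search-splits : (R S : List A → A → Set) → (∀ P y → R P y ⊎ S P y) → ∀ l →
  (∀ P y Q → l ≡ P ++ y ∷ Q → R P y) ⊎ ∃₂ λ P y → ∃ λ Q → l ≡ P ++ y ∷ Q × S P y
search-splits R S dec [] = inj₁ λ { [] y Q () ; (_ ∷ _) y Q () }
search-splits R S dec (x ∷ l) with dec [] x
... | inj₂ s = inj₂ ([] , x , l , refl , s)
... | inj₁ r with search-splits (R ∘ (x ∷_)) (S ∘ (x ∷_)) (dec ∘ (x ∷_)) l
...   | inj₂ (P , y , Q , e , s) = inj₂ (x ∷ P , y , Q , cong (x ∷_) e , s)
...   | inj₁ h = inj₁ λ { [] _ _ refl → r ; (_ ∷ P) y Q refl → h P y Q refl }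

module _ {N} (T : Digraph N) (tour : IsTournament T) where

  -- A median order usually means one that maximises the number of forward edges. Only the
  -- consequence in use is kept; it already holds when no move of one vertex to an earlier place
  -- increases `forward`.
  MedianOrder : List (Fin N) → Set
  MedianOrder l = ∀ xs seg y zs → l ≡ xs ++ seg ++ y ∷ zs →
    length seg ≤ 2 * # (λ x → T x y) seg

  forward : List (Fin N) → ℕ
  forward []       = 0
  forward (x ∷ xs) = # (T x) xs + forward xs

  forward≤ : ∀ l → forward l ≤ length l * length l
  forward≤ []       = z≤n
  forward≤ (x ∷ xs) = begin
    # (T x) xs + forward xs              ≤⟨ +-mono-≤ (#≤length (T x) xs) (forward≤ xs) ⟩
    m + m * m                            ≤⟨ m≤n+m _ (suc m) ⟩
    suc m + (m + m * m)                  ≡⟨ lem m ⟩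
    suc m * suc m                        ∎
    where
    open ≤-Reasoning
    m = length xs
    lem : ∀ m → suc m + (m + m * m) ≡ suc m * suc m
    lem = solve-∀

  opposite : ∀ seg {y} → y ∉ seg → # (T y) seg + # (λ x → T x y) seg ≡ length seg
  opposite []        y∉ = refl
  opposite (x ∷ seg) {y} y∉ with proj₂ tour x y (λ e → y∉ (here (sym e)))
  ... | inj₁ (p , q) rewrite p | q = trans (+-suc _ _) (cong suc (opposite seg (y∉ ∘ there)))
  ... | inj₂ (p , q) rewrite p | q = cong suc (opposite seg (y∉ ∘ there))

  forward-∷ʳ : ∀ seg y zs →
    forward (seg ++ y ∷ zs) ≡ forward (seg ++ zs) + # (λ x → T x y) seg + # (T y) zs
  forward-∷ʳ [] y zs = lem (# (T y) zs) (forward zs)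
    where
    lem : ∀ a b → a + b ≡ b + 0 + a
    lem = solve-∀
  forward-∷ʳ (x ∷ seg) y zs
    rewrite forward-∷ʳ seg y zs | ∑-++ seg (y ∷ zs) (𝟙 ∘ T x) | ∑-++ seg zs (𝟙 ∘ T x) =
    lem (# (T x) seg) (𝟙 (T x y)) (# (T x) zs) (forward (seg ++ zs)) (# (λ x → T x y) seg) (# (T y) zs)
    where
    lem : ∀ a b c d e f → a + (b + c) + (d + e + f) ≡ a + c + d + (b + e) + f
    lem = solve-∀

  -- Moving `y` in front of `seg` affects only the pairs of `y` with `seg`; by `opposite`, the
  -- out-edges gained outnumber the in-edges lost.
  improve : ∀ xs seg y zs → y ∉ seg → 2 * # (λ x → T x y) seg < length seg →
    forward (xs ++ seg ++ y ∷ zs) < forward (xs ++ y ∷ seg ++ zs)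
  improve [] seg y zs y∉ lt = begin-strict
    forward (seg ++ y ∷ zs)                        ≡⟨ forward-∷ʳ seg y zs ⟩
    forward (seg ++ zs) + i + # (T y) zs           <⟨ +-monoˡ-< (# (T y) zs) (+-monoʳ-< (forward (seg ++ zs)) i<o) ⟩
    forward (seg ++ zs) + # (T y) seg + # (T y) zs ≡⟨ lem (forward (seg ++ zs)) (# (T y) seg) (# (T y) zs) ⟩
    # (T y) seg + # (T y) zs + forward (seg ++ zs) ≡⟨ cong (_+ forward (seg ++ zs)) (∑-++ seg zs (𝟙 ∘ T y)) ⟨
    # (T y) (seg ++ zs) + forward (seg ++ zs)      ∎
    where
    open ≤-Reasoning
    i = # (λ x → T x y) seg
    lem : ∀ a b c → a + b + c ≡ b + c + a
    lem = solve-∀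
    i<o : i < # (T y) seg
    i<o = +-cancelʳ-< i _ _ (subst₂ _<_ (cong (i +_) (+-identityʳ i)) (sym (opposite seg y∉)) lt)
  improve (x ∷ xs) seg y zs y∉ lt = +-mono-≤-< (≤-reflexive same) (improve xs seg y zs y∉ lt)
    where
    same : # (T x) (xs ++ seg ++ y ∷ zs) ≡ # (T x) (xs ++ y ∷ seg ++ zs)
    same rewrite ∑-++ xs (seg ++ y ∷ zs) (𝟙 ∘ T x) | ∑-++ xs (y ∷ seg ++ zs) (𝟙 ∘ T x)
      | ∑-++ seg (y ∷ zs) (𝟙 ∘ T x) | ∑-++ seg zs (𝟙 ∘ T x) =
      lem (# (T x) xs) (# (T x) seg) (𝟙 (T x y)) (# (T x) zs)
      where
      lem : ∀ a b c d → a + (b + (c + d)) ≡ a + (c + (b + d))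
      lem = solve-∀

  private
    Fine Violated : List (Fin N) → Fin N → Set
    Fine P y = ∀ xs seg → P ≡ xs ++ seg → length seg ≤ 2 * # (λ x → T x y) seg
    Violated P y = ∃₂ λ xs seg → P ≡ xs ++ seg × 2 * # (λ x → T x y) seg < length seg

    step : ∀ l → MedianOrder l ⊎
      (∃₂ λ xs seg → ∃₂ λ y zs → l ≡ xs ++ seg ++ y ∷ zs × 2 * # (λ x → T x y) seg < length seg)
    step l with search-splits Fine Violated
      (λ P y → search-suffixes _ _ (λ seg → ≤-<-connex (length seg) (2 * # (λ x → T x y) seg)) P) l
    ... | inj₁ h = inj₁ λ xs seg y zs e →
      h (xs ++ seg) y zs (trans e (sym (++-assoc xs seg (y ∷ zs)))) xs seg refl
    ... | inj₂ (_ , y , zs , e , xs , seg , refl , lt) =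
      inj₂ (xs , seg , y , zs , trans e (++-assoc xs seg (y ∷ zs)) , lt)

  -- Local search. `fuel` bounds the distance from `forward l` to the upper bound
  -- `length l * length l`, which permutations preserve, and every improving move shortens that
  -- distance.
  ∃-medianOrder : ∀ l → Unique l → ∃ λ l′ → l ↭ l′ × MedianOrder l′
  ∃-medianOrder l un = go (length l * length l) l un (m≤m+n _ (forward l))
    where
    go : ∀ fuel l → Unique l → length l * length l ≤ fuel + forward l → ∃ λ l′ → l ↭ l′ × MedianOrder l′
    go fuel l un h with step l
    go fuel l un h | inj₁ med = l , ↭-refl , med
    go fuel l un h | inj₂ (xs , seg , y , zs , refl , lt) = continue fuel h
      where
      l₁ = xs ++ y ∷ seg ++ zs
      l↭l₁ : l ↭ l₁
      l↭l₁ = ++⁺ˡ xs (shift y seg zs)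
      y∉seg : y ∉ seg
      y∉seg y∈ = ∉-++ seg (Unique-++⁻ʳ xs un) y∈ (here refl)
      better : forward l < forward l₁
      better = improve xs seg y zs y∉seg lt
      continue : ∀ fuel → length l * length l ≤ fuel + forward l → ∃ λ l′ → l ↭ l′ × MedianOrder l′
      continue zero h = ⊥-elim (<-irrefl refl (begin-strict
        length l * length l    ≤⟨ h ⟩
        forward l              <⟨ better ⟩
        forward l₁             ≤⟨ forward≤ l₁ ⟩
        length l₁ * length l₁  ≡⟨ cong (λ k → k * k) (↭-length l↭l₁) ⟨
        length l * length l    ∎))
        where open ≤-Reasoning
      continue (suc fuel) h = map₂ (λ (p , m) → ↭-trans l↭l₁ p , m)
        (go fuel l₁ (Unique-resp-↭ l↭l₁ un) (begin
          length l₁ * length l₁  ≡⟨ cong (λ k → k * k) (↭-length l↭l₁) ⟨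
          length l * length l    ≤⟨ h ⟩
          suc fuel + forward l   ≡⟨ +-suc fuel (forward l) ⟨
          fuel + suc (forward l) ≤⟨ +-monoʳ-≤ fuel better ⟩
          fuel + forward l₁      ∎))
        where open ≤-Reasoning

-- Windows in a median order

split-at : ∀ k (l : List A) → k ≤ length l → ∃₂ λ xs ys → l ≡ xs ++ ys × length xs ≡ k
split-at k l k≤ = take k l , drop k l , sym (take++drop≡id k l) ,
  trans (length-take k l) (m≤n⇒m⊓n≡m k≤)

-- Averaging: if the first block falls short of the density, the remainder still attains it, down to
-- a single last block.
dense-block : ∀ (h : A → ℕ) t b w k (I : List A) → length I ≡ suc k * w → length I * t ≤ b * ∑ I h →
  ∃₂ λ I₁ J → ∃ λ I₂ → I ≡ I₁ ++ J ++ I₂ × length J ≡ w × length J * t ≤ b * ∑ J h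
dense-block h t b w zero I len dense =
  [] , I , [] , sym (++-identityʳ I) , trans len (+-identityʳ w) , dense
dense-block h t b w (suc k) I len dense
  with split-at w I (≤-trans (m≤m+n w (suc k * w)) (≤-reflexive (sym len)))
... | J , I′ , refl , refl with length J * t ≤? b * ∑ J h
...   | yes ok = [] , J , I′ , refl , refl , ok
...   | no ¬ok with dense-block h t b w k I′ len′ dense′
  where
  len′ : length I′ ≡ suc k * w
  len′ = +-cancelˡ-≡ w _ _ (trans (sym (length-++ J)) len)
  dense′ : length I′ * t ≤ b * ∑ I′ h
  dense′ = +-cancelˡ-≤ (length J * t) _ _ (begin
    length J * t + length I′ * t  ≡⟨ *-distribʳ-+ t (length J) _ ⟨
    (length J + length I′) * t    ≡⟨ cong (_* t) (length-++ J) ⟨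
    length (J ++ I′) * t          ≤⟨ dense ⟩
    b * ∑ (J ++ I′) h             ≡⟨ trans (cong (b *_) (∑-++ J I′ h)) (*-distribˡ-+ b (∑ J h) _) ⟩
    b * ∑ J h + b * ∑ I′ h        ≤⟨ +-monoˡ-≤ (b * ∑ I′ h) (≰⇒≥ ¬ok) ⟩
    length J * t + b * ∑ I′ h     ∎)
    where open ≤-Reasoning
...     | I₁ , J₁ , I₂ , refl , len₁ , dense₁ = J ++ I₁ , J₁ , I₂ , sym (++-assoc J I₁ _) , len₁ , dense₁

-- Makes the interval a whole number of blocks, exceeding the length `x` required for the density by
-- at most one block.
multiple-between : ∀ x w .{{_ : NonZero w}} → ∃ λ k → x ≤ suc k * w × suc k * w ≤ x + w
multiple-between x w = x / w ,
  ≤-trans (≤-reflexive (m≡m%n+[m/n]*n x w)) (+-monoˡ-≤ (x / w * w) (<⇒≤ (m%n<n x w))) ,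
  ≤-trans (≤-reflexive (+-comm w _)) (+-monoˡ-≤ w (≤-trans (m≤n+m (x / w * w) (x % w)) (≤-reflexive (sym (m≡m%n+[m/n]*n x w)))))

module _ {N} (T : Digraph N) (tour : IsTournament T) (ord : List (Fin N)) (median : MedianOrder T tour ord) where

  -- Apply the median property to `I ++ α`, where `α` is the part of `J` before `y`. Counting all of
  -- `α` as in-neighbours costs `length α`, at most `length J`.
  in-degree : ∀ P I J rest {y} → ord ≡ P ++ I ++ J ++ rest → y ∈ J →
    length I ≤ 2 * # (λ x → T x y) I + length J
  in-degree P I J rest {y} e y∈ with ∈-∃++ y∈
  ... | α , β , refl = +-cancelʳ-≤ (length α) _ _ (begin
    length I + length α                            ≡⟨ length-++ I ⟨
    length (I ++ α)                                ≤⟨ median P (I ++ α) y (β ++ rest) e′ ⟩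
    2 * # (λ x → T x y) (I ++ α)                   ≡⟨ cong (2 *_) (∑-++ I α _) ⟩
    2 * (# (λ x → T x y) I + # (λ x → T x y) α)    ≤⟨ *-monoʳ-≤ 2 (+-monoʳ-≤ (# (λ x → T x y) I) (#≤length _ α)) ⟩
    2 * (# (λ x → T x y) I + length α)             ≡⟨ lem (# (λ x → T x y) I) (length α) ⟩
    2 * # (λ x → T x y) I + length α + length α    ≤⟨ +-monoˡ-≤ (length α) (+-monoʳ-≤ (2 * # (λ x → T x y) I) α≤) ⟩
    2 * # (λ x → T x y) I + length (α ++ y ∷ β) + length α ∎)
    where
    open ≤-Reasoning
    lem : ∀ p q → 2 * (p + q) ≡ 2 * p + q + q
    lem = solve-∀
    α≤ : length α ≤ length (α ++ y ∷ β)
    α≤ = ≤-trans (m≤m+n (length α) _) (≤-reflexive (sym (length-++ α)))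
    e′ : ord ≡ P ++ (I ++ α) ++ y ∷ β ++ rest
    e′ = trans e (cong (P ++_) (trans (cong (I ++_) (++-assoc α (y ∷ β) rest)) (sym (++-assoc I α _))))

  -- The error `length J` is at most the fraction `1 / suc a` of `length I`, so each `y` in `U`
  -- receives edges from at least the fraction `a / (2 * suc a)` of `I`.
  in-density : ∀ a P I J rest U → ord ≡ P ++ I ++ J ++ rest → U ⊆ J → suc a * length J ≤ length I →
    length I * (a * length U) ≤ 2 * suc a * ∑ I (λ x → # (T x) U)
  in-density a P I J rest U e U⊆J J≤I = begin
    L * (a * length U)                                  ≡⟨ lem L a (length U) ⟩
    length U * (a * L)                                  ≡⟨ ∑-const U (a * L) ⟨
    ∑ U (λ _ → a * L)                                   ≤⟨ ∑-mono-∈ U each ⟩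
    ∑ U (λ y → 2 * suc a * # (λ x → T x y) I)           ≡⟨ ∑-*ˡ U (2 * suc a) _ ⟩
    2 * suc a * ∑ U (λ y → # (λ x → T x y) I)           ≡⟨ cong (2 * suc a *_) (∑-swap U I (λ y x → 𝟙 (T x y))) ⟩
    2 * suc a * ∑ I (λ x → # (T x) U)                   ∎
    where
    open ≤-Reasoning
    L = length I
    lem : ∀ p q r → p * (q * r) ≡ r * (q * p)
    lem = solve-∀
    each : ∀ {y} → y ∈ U → a * L ≤ 2 * suc a * # (λ x → T x y) I
    each {y} y∈ = +-cancelˡ-≤ L _ _ (begin
      L + a * L                            ≤⟨ *-monoʳ-≤ (suc a) (in-degree P I J rest e (U⊆J y∈)) ⟩
      suc a * (2 * i + length J)           ≡⟨ lem₂ (suc a) i (length J) ⟩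
      suc a * length J + 2 * suc a * i     ≤⟨ +-monoˡ-≤ _ J≤I ⟩
      L + 2 * suc a * i                    ∎)
      where
      i = # (λ x → T x y) I
      lem₂ : ∀ p q r → p * (2 * q + r) ≡ p * r + 2 * p * q
      lem₂ = solve-∀

  -- Descending through the levels along the order

  module Chain {n} (E : Digraph n) (lev : Fin n → ℕ)
    (lev-suc : ∀ u w → E u w ≡ true → lev w ≡ suc (lev u))
    (d D : ℕ) .{{_ : NonZero D}}
    (inDeg≤ : ∀ w → # (λ u → E u w) (allFin n) ≤ d)
    (outDeg≤ : ∀ u → # (E u) (allFin n) ≤ D)
    (ord-unique : Unique ord) (x₀ : Fin N)
    (a B R s : ℕ) .{{_ : NonZero B}} .{{_ : NonZero R}}
    (R-large : 2 * (2 * suc a) ^ s ≤ R * a ^ s)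
    (s-large : R ^ suc d * (2 * B) ^ d * D ^ d < B ^ s) where

    open Layered T E Fin._≟_ lev lev-suc d D inDeg≤ outDeg≤

    -- `2 * size i` is the room for the greedy choice, `B` the loss in passing to a common
    -- out-neighbourhood, and `R` the loss in passing from a block to a common in-neighbourhood.
    width : ℕ → ℕ
    width i = 2 * B * R * size i

    -- `budget` is the room needed before `J`. Descending from `i` to `i - 1` consumes at most
    -- `suc a * width i + width (i - 1)`, so each level is charged `suc (suc a)` widths in total.
    record State (i : ℕ) : Set where
      field
        pre J rest U : List (Fin N)
        ord≡   : ord ≡ pre ++ J ++ rest
        J-len  : length J ≡ width i
        U⊆J    : U ⊆ J
        U-uniq : Unique U
        U-len  : 2 * B * size i ≤ length U
        ready  : Ready i U (J ++ rest)
        budget : suc (suc a) * ∑ (downFrom i) width + suc a * width i ≤ length pre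

    private
      R*≡ : ∀ B R v → R * (2 * B * v) ≡ 2 * B * R * v
      R*≡ = solve-∀

      -- The sizes `v` and `c` of the two levels cancel: with `m` proportional to `v` and `u` at
      -- least `B * (2 * c)`, only `s-large` remains.
      few : ∀ {m u} v c → m ≡ 2 * B * R * v → 2 * B * c ≤ u → .{{_ : NonZero v}} .{{_ : NonZero c}} →
        m ^ suc d * (2 * c) ^ s * D ^ d < u ^ s * (2 * B * v) * v ^ d
      few {m} {u} v c refl cu = begin-strict
        m ^ suc d * (2 * c) ^ s * D ^ d
          ≡⟨ cong (λ z → z * (2 * c) ^ s * D ^ d) (trans (cong (_^ suc d) (sym (R*≡ B R v)))
               (trans (^-distribʳ-* (suc d) R (2 * B * v)) (cong (R ^ suc d *_) (cong (2 * B * v *_) (^-distribʳ-* d (2 * B) v))))) ⟩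
        R ^ suc d * (2 * B * v * ((2 * B) ^ d * v ^ d)) * (2 * c) ^ s * D ^ d
          ≡⟨ lem₁ (R ^ suc d) (2 * B * v) ((2 * B) ^ d) (v ^ d) ((2 * c) ^ s) (D ^ d) ⟩
        R ^ suc d * (2 * B) ^ d * D ^ d * ((2 * c) ^ s * (2 * B * v) * v ^ d)
          <⟨ *-monoˡ-< _ {{pos}} s-large ⟩
        B ^ s * ((2 * c) ^ s * (2 * B * v) * v ^ d)
          ≡⟨ lem₂ (B ^ s) ((2 * c) ^ s) (2 * B * v) (v ^ d) ⟩
        B ^ s * (2 * c) ^ s * (2 * B * v) * v ^ d
          ≡⟨ cong (λ z → z * (2 * B * v) * v ^ d) (^-distribʳ-* s B (2 * c)) ⟨
        (B * (2 * c)) ^ s * (2 * B * v) * v ^ d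
          ≤⟨ *-monoˡ-≤ (v ^ d) (*-monoˡ-≤ (2 * B * v) (^-monoˡ-≤ s (≤-trans (≤-reflexive (lem₃ B c)) cu))) ⟩
        u ^ s * (2 * B * v) * v ^ d ∎
        where
        open ≤-Reasoning
        lem₁ : ∀ r x y z t e → r * (x * (y * z)) * t * e ≡ r * y * e * (t * x * z)
        lem₁ = solve-∀
        lem₂ : ∀ p q r t → p * (q * r * t) ≡ p * q * r * t
        lem₂ = solve-∀
        lem₃ : ∀ p q → p * (2 * q) ≡ 2 * p * q
        lem₃ = solve-∀
        pos : NonZero ((2 * c) ^ s * (2 * B * v) * v ^ d)
        pos = m*n≢0 _ _ {{m*n≢0 _ _ {{m^n≢0 (2 * c) s {{m*n≢0 2 c}}}} {{m*n≢0 (2 * B) v {{m*n≢0 2 B}}}}}} {{m^n≢0 v d}}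

      nonZero-width : ∀ i → NonZero (width i)
      nonZero-width i = m*n≢0 _ (size i) {{m*n≢0 (2 * B) R {{m*n≢0 2 B}}}}

    -- `J₁` is the dense block for level `i`. The part of the interval in front of it is returned to
    -- `P`; the part `I₂` behind it receives no vertex.
    record Window (i : ℕ) (J rest U : List (Fin N)) : Set where
      field
        P J₁ I₂ : List (Fin N)
        ord≡    : ord ≡ P ++ J₁ ++ I₂ ++ J ++ rest
        J₁-len  : length J₁ ≡ width i
        dense   : length J₁ * (a * length U) ≤ 2 * suc a * ∑ J₁ (λ x → # (T x) U)
        budget  : suc (suc a) * ∑ (downFrom i) width + suc a * width i ≤ length P

    window : ∀ i pre J rest U → ord ≡ pre ++ J ++ rest → length J ≡ width (suc i) → U ⊆ J →
      suc (suc a) * ∑ (downFrom (suc i)) width + suc a * width (suc i) ≤ length pre →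
      Window i J rest U
    window i pre J rest U ord≡ J-len U⊆J budget
      with multiple-between (suc a * width (suc i)) (width i) {{nonZero-width i}}
    ... | k , L≥ , L≤ = go (split-at (length pre ∸ L) pre (m∸n≤m (length pre) L))
      where
      L = suc k * width i
      S = ∑ (downFrom i) width
      fits : L ≤ length pre
      fits = begin
        L                                              ≤⟨ L≤ ⟩
        suc a * width (suc i) + width i                ≡⟨ +-comm (suc a * width (suc i)) (width i) ⟩
        width i + suc a * width (suc i)                ≤⟨ +-monoˡ-≤ _ (m≤m+n (width i) S) ⟩
        width i + S + suc a * width (suc i)            ≤⟨ +-monoˡ-≤ _ (m≤n*m (width i + S) (suc (suc a))) ⟩
        suc (suc a) * (width i + S) + suc a * width (suc i) ≤⟨ budget ⟩
        length pre                                     ∎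
        where open ≤-Reasoning
      go : (∃₂ λ P I → pre ≡ P ++ I × length P ≡ length pre ∸ L) → Window i J rest U
      go (P , I , pre≡ , P-len) = go′ (dense-block (λ x → # (T x) U) (a * length U) (2 * suc a) (width i) k I I-len
        (in-density a P I J rest U (trans ord≡ (trans (cong (_++ J ++ rest) pre≡) (++-assoc P I (J ++ rest)))) U⊆J
          (≤-trans (*-monoʳ-≤ (suc a) (≤-reflexive J-len)) (≤-trans L≥ (≤-reflexive (sym I-len))))))
        where
        I-len : length I ≡ L
        I-len = +-cancelˡ-≡ (length P) (length I) L (trans (sym (length-++ P)) (trans (cong length (sym pre≡))
          (trans (sym (m∸n+n≡m fits)) (cong (_+ L) (sym P-len)))))
        budget′ : suc (suc a) * S + suc a * width i ≤ length P
        budget′ = +-cancelʳ-≤ L _ _ (begin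
          suc (suc a) * S + suc a * width i + L
            ≤⟨ +-monoʳ-≤ (suc (suc a) * S + suc a * width i) L≤ ⟩
          suc (suc a) * S + suc a * width i + (suc a * width (suc i) + width i)
            ≡⟨ lem a S (width i) (width (suc i)) ⟩
          suc (suc a) * (width i + S) + suc a * width (suc i)
            ≤⟨ budget ⟩
          length pre
            ≡⟨ m∸n+n≡m fits ⟨
          length pre ∸ L + L
            ≡⟨ cong (_+ L) P-len ⟨
          length P + L ∎)
          where
          open ≤-Reasoning
          lem : ∀ a S w w′ → suc (suc a) * S + suc a * w + (suc a * w′ + w) ≡ suc (suc a) * (w + S) + suc a * w′
          lem = solve-∀
        go′ : (∃₂ λ I₁ J₁ → ∃ λ I₂ → I ≡ I₁ ++ J₁ ++ I₂ × length J₁ ≡ width i ×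
                length J₁ * (a * length U) ≤ 2 * suc a * ∑ J₁ (λ x → # (T x) U)) → Window i J rest U
        go′ (I₁ , J₁ , I₂ , I≡ , J₁-len , dense) = record
          { P = P ++ I₁ ; J₁ = J₁ ; I₂ = I₂
          ; ord≡ = begin
              ord                                     ≡⟨ ord≡ ⟩
              pre ++ J ++ rest                        ≡⟨ cong (_++ J ++ rest) (trans pre≡ (cong (P ++_) I≡)) ⟩
              (P ++ I₁ ++ J₁ ++ I₂) ++ J ++ rest      ≡⟨ cong (_++ J ++ rest) (++-assoc P I₁ (J₁ ++ I₂)) ⟨
              ((P ++ I₁) ++ J₁ ++ I₂) ++ J ++ rest    ≡⟨ ++-assoc (P ++ I₁) (J₁ ++ I₂) (J ++ rest) ⟩
              (P ++ I₁) ++ (J₁ ++ I₂) ++ J ++ rest    ≡⟨ cong ((P ++ I₁) ++_) (++-assoc J₁ I₂ (J ++ rest)) ⟩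
              (P ++ I₁) ++ J₁ ++ I₂ ++ J ++ rest      ∎
          ; J₁-len = J₁-len
          ; dense = dense
          ; budget = ≤-trans budget′ (≤-trans (m≤m+n (length P) (length I₁)) (≤-reflexive (sym (length-++ P)))) }
          where open ≡-Reasoning

    extend : ∀ i (st : State (suc i)) (w : Window i (State.J st) (State.rest st) (State.U st)) ys →
      2 * B * size i < length (inNbhd T (Window.J₁ w) ys) →
      ∑ᵗ (inNbhd T (Window.J₁ w) ys) d (poor T (State.U st) (2 * size (suc i))) [] * D ^ d < size i ^ d → State i
    extend i st w ys many promising = record
      { pre = P ; J = J₁ ; rest = I₂ ++ J ++ rest ; U = U₁
      ; ord≡ = W.ord≡
      ; J-len = J₁-len
      ; U⊆J = U₁⊆J₁
      ; U-uniq = U₁-unique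
      ; U-len = <⇒≤ many
      ; ready = ready-step i {U = U₁} {U′ = U} {S′ = J ++ rest} U₁-unique (∈-++⁺ˡ ∘ U₁⊆J₁) (∈-++⁺ʳ J₁ ∘ ∈-++⁺ʳ I₂)
          (λ x∈ x∈′ → ∉-++ J₁ J₁rest-unique (U₁⊆J₁ x∈) (∈-++⁺ʳ I₂ x∈′))
          x₀ (≤-trans (m≤n*m (size i) (2 * B) {{m*n≢0 2 B}}) (<⇒≤ many)) promising ready
      ; budget = W.budget }
      where
      open State st
      module W = Window w
      open W using (P; J₁; I₂; J₁-len)
      U₁ = inNbhd T J₁ ys
      J₁rest-unique : Unique (J₁ ++ I₂ ++ J ++ rest)
      J₁rest-unique = Unique-++⁻ʳ P (subst Unique W.ord≡ ord-unique)
      U₁⊆J₁ : U₁ ⊆ J₁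
      U₁⊆J₁ x∈ = proj₁ (∈-filter⁻ (λ _ → T? _) x∈)
      U₁-unique : Unique U₁
      U₁-unique = filter⁺ _ (Unique-++⁻ˡ J₁ J₁rest-unique)

    descend : ∀ i → State (suc i) → State i
    descend i st = extend i st w (proj₁ choice) (proj₁ (proj₂ choice)) (proj₂ (proj₂ choice))
      where
      open State st
      w : Window i J rest U
      w = window i pre J rest U ord≡ J-len U⊆J budget
      open Window w using (J₁; J₁-len; dense)
      large : 2 * (2 * B * size i) * (2 * suc a) ^ s ≤ length J₁ * a ^ s
      large = begin
        2 * (2 * B * size i) * (2 * suc a) ^ s   ≡⟨ lem 2 (2 * B * size i) ((2 * suc a) ^ s) ⟩
        2 * B * size i * (2 * (2 * suc a) ^ s)   ≤⟨ *-monoʳ-≤ (2 * B * size i) R-large ⟩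
        2 * B * size i * (R * a ^ s)             ≡⟨ lem′ (2 * B * size i) R (a ^ s) ⟩
        R * (2 * B * size i) * a ^ s             ≡⟨ cong (_* a ^ s) (trans (R*≡ B R (size i)) (sym J₁-len)) ⟩
        length J₁ * a ^ s                        ∎
        where
        open ≤-Reasoning
        lem : ∀ p q r → p * q * r ≡ q * (p * r)
        lem = solve-∀
        lem′ : ∀ p q r → p * (q * r) ≡ q * p * r
        lem′ = solve-∀
      choice : ∃ λ ys → 2 * B * size i < length (inNbhd T J₁ ys) ×
        ∑ᵗ (inNbhd T J₁ ys) d (poor T U (2 * size (suc i))) [] * D ^ d < size i ^ d
      choice = dependent-random-choice T J₁ U (2 * size (suc i)) (2 * B * size i) (size i) D d s a (2 * suc a)
        dense large (few (size i) (size (suc i)) J₁-len U-len)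

    descend-all : ∀ i → State i → State 0
    descend-all zero    st = st
    descend-all (suc i) st = descend-all i (descend i st)

    -- The descent starts one level above the last. No vertex has level `H`, so `ready` holds
    -- vacuously and the final `width H` vertices of the order will do.
    top : ∀ H → (∀ x → lev x < H) → suc (suc a) * ∑ (downFrom (suc H)) width ≤ length ord → State H
    top H lev< enough with split-at (length ord ∸ width H) ord (m∸n≤m (length ord) (width H))
    ... | pre , J , e , pre-len = record
      { pre = pre ; J = J ; rest = [] ; U = J
      ; ord≡ = trans e (cong (pre ++_) (sym (++-identityʳ J)))
      ; J-len = J-len
      ; U⊆J = λ x∈ → x∈
      ; U-uniq = Unique-++⁻ʳ pre (subst Unique e ord-unique)
      ; U-len = ≤-trans (*-monoˡ-≤ (size H) (m≤m*n (2 * B) R)) (≤-reflexive (sym J-len))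
      ; ready = λ C _ → record
          { f = λ _ → x₀
          ; f-∈ = λ H≤ → none H≤ ; f-C = λ eq → none (≤-reflexive (sym eq))
          ; f-inj = λ H≤ → none H≤ ; f-hom = λ H≤ → none H≤ }
      ; budget = +-cancelʳ-≤ (width H) _ _ (begin
          suc (suc a) * S + suc a * width H + width H ≡⟨ lem a S (width H) ⟩
          suc (suc a) * (width H + S)                 ≤⟨ enough ⟩
          length ord                                  ≡⟨ m∸n+n≡m fits ⟨
          length ord ∸ width H + width H              ≡⟨ cong (_+ width H) pre-len ⟨
          length pre + width H                        ∎) }
      where
      open ≤-Reasoning
      S = ∑ (downFrom H) width
      lem : ∀ a S w → suc (suc a) * S + suc a * w + w ≡ suc (suc a) * (w + S)
      lem = solve-∀
      fits : width H ≤ length ord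
      fits = ≤-trans (≤-trans (m≤m+n (width H) S) (m≤n*m _ (suc (suc a)))) enough
      J-len : length J ≡ width H
      J-len = +-cancelˡ-≡ (length pre) _ _ (trans (sym (length-++ pre)) (trans (cong length (sym e))
        (trans (sym (m∸n+n≡m fits)) (cong (_+ width H) (sym pre-len)))))
      none : ∀ {X : Set} {x} → H ≤ lev x → X
      none {x = x} H≤ = ⊥-elim (<-irrefl refl (<-≤-trans (lev< x) H≤))

    ∑-size : ∀ H → ∑ (downFrom H) size ≤ H + n
    ∑-size H = begin
      ∑ (downFrom H) size
        ≡⟨ ∑-+ (downFrom H) (λ _ → 1) (length ∘ layer) ⟩
      ∑ (downFrom H) (λ _ → 1) + ∑ (downFrom H) (length ∘ layer)
        ≡⟨ cong₂ _+_ (trans (∑-const (downFrom H) 1) (trans (*-identityʳ _) (length-downFrom H)))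
             (∑-cong (downFrom H) (λ i → length-filterᵇ _ (allFin n))) ⟩
      H + ∑ (downFrom H) (λ i → # (λ x → i ≡ᵇ lev x) (allFin n))
        ≤⟨ +-monoʳ-≤ H (∑-fiber-≤ (allFin n) (downFrom H) (λ x i → i ≡ᵇ lev x)
             (λ x → #-≟≤1 _≟_ (lev x) (downFrom⁺ H))) ⟩
      H + length (allFin n)
        ≡⟨ cong (H +_) (length-tabulate (λ x → x)) ⟩
      H + n ∎
      where
      open ≤-Reasoning

    embed : ∀ H → (∀ x → lev x < H) → suc (suc a) * (2 * B * R) * (suc H + n) ≤ length ord → Contains T E
    embed H lev< enough = F.f , (λ e → F.f-inj z≤n z≤n e) , (λ u w e → F.f-hom z≤n e)
      where
      open ≤-Reasoning
      st : State 0
      st = descend-all H (top H lev< (begin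
        suc (suc a) * ∑ (downFrom (suc H)) width
          ≡⟨ trans (cong (suc (suc a) *_) (∑-*ˡ (downFrom (suc H)) (2 * B * R) size)) (sym (*-assoc (suc (suc a)) (2 * B * R) (∑ (downFrom (suc H)) size))) ⟩
        suc (suc a) * (2 * B * R) * ∑ (downFrom (suc H)) size
          ≤⟨ *-monoʳ-≤ (suc (suc a) * (2 * B * R)) (∑-size (suc H)) ⟩
        suc (suc a) * (2 * B * R) * (suc H + n)
          ≤⟨ enough ⟩
        length ord ∎))
      open State st
      -- Vertices of level 0 have no in-neighbours to respect, so all of `U` is allowed; it is large
      -- enough because `B ≥ 1`.
      module F = Embedding (ready (λ _ _ → true) (λ _ → ≤-trans (*-monoˡ-≤ (size 0) (*-monoʳ-≤ 2 (>-nonZero⁻¹ B)))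
        (≤-trans U-len (≤-reflexive (sym (trans (∑-const U 1) (*-identityʳ _)))))))

-- Degrees and gradings

𝟙≤# : ∀ (p : A → Bool) {xs x} → x ∈ xs → 𝟙 (p x) ≤ # p xs
𝟙≤# p (here refl) = m≤m+n _ _
𝟙≤# p {y ∷ _} (there x∈) = ≤-trans (𝟙≤# p x∈) (m≤n+m _ (𝟙 (p y)))

#-allFin : ∀ {n} (p : Fin n → Bool) → # p (allFin n) ≡ count p
#-allFin p = go p (λ i → i)
  where
  go : ∀ {m n} (p : Fin n → Bool) (f : Fin m → Fin n) → # p (tabulate f) ≡ count (p ∘ f)
  go {zero}  p f = refl
  go {suc m} p f = cong (𝟙 (p (f zero)) +_) (go p (f ∘ suc))

count-mono : ∀ {n} {p q : Fin n → Bool} → (∀ i → p i ≡ true → q i ≡ true) → count p ≤ count q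
count-mono {n} {p} {q} h = subst₂ _≤_ (#-allFin p) (#-allFin q) (∑-mono (allFin n) (λ i → 𝟙-mono (h i)))

count-∃ : ∀ {n} (p : Fin n → Bool) → 1 ≤ count p → ∃ λ i → p i ≡ true
count-∃ {n} p h with ∃-avoiding [] p (allFin n) (subst (1 ≤_) (sym (#-allFin p)) h)
... | i , _ , e , _ = i , e

1≤count : ∀ {n} (p : Fin n → Bool) {i} → p i ≡ true → 1 ≤ count p
1≤count p {i} e = subst₂ _≤_ (cong 𝟙 e) (#-allFin p) (𝟙≤# p (∈-allFin i))

≤maxFin : ∀ {n} (f : Fin n → ℕ) i → f i ≤ maxFin f
≤maxFin f zero    = m≤m⊔n _ _
≤maxFin f (suc i) = ≤-trans (≤maxFin (f ∘ suc) i) (m≤n⊔m (f zero) _)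

maxFin-mono : ∀ {n} {f g : Fin n → ℕ} → (∀ i → f i ≤ g i) → maxFin f ≤ maxFin g
maxFin-mono {zero}  h = z≤n
maxFin-mono {suc n} h = ⊔-mono-≤ (h zero) (maxFin-mono (h ∘ suc))

maxFin-∃ : ∀ {n} (f : Fin n → ℕ) → 1 ≤ maxFin f → ∃ λ i → 1 ≤ f i
maxFin-∃ {suc n} f h with ⊔-sel (f zero) (maxFin (f ∘ suc))
... | inj₁ e = zero , subst (1 ≤_) e h
... | inj₂ e with maxFin-∃ (f ∘ suc) (subst (1 ≤_) e h)
...   | i , p = suc i , p

-- A single edge makes `n`, the maximum in-degree and the maximum out-degree positive, as `arrows`
-- requires.
∃-edge : ∀ {n} (E : Digraph n) → 1 ≤ maxDeg E → ∃₂ λ u w → E u w ≡ true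
∃-edge E h with maxFin-∃ (deg E) h
... | v , p with count-∃ (λ u → E v u ∨ E u v) p
...   | u , e with E v u in eq
...     | true  = v , u , eq
...     | false = u , v , e

record Grading {n} (E : Digraph n) (H : ℕ) : Set where
  field
    lev     : Fin n → ℕ
    lev<    : ∀ x → lev x < H
    lev-suc : ∀ u w → E u w ≡ true → lev w ≡ suc (lev u)

-- Edges rise by exactly one level, so none can pass the empty level `j`. Lowering everything above
-- `j` by one therefore moves both ends of an edge or neither.
delete-level : ∀ {n} {E : Digraph n} {H} (γ : Grading E (suc H)) j → j ≤ H →
  (∀ x → Grading.lev γ x ≢ j) → Grading E H
delete-level {n} {E} {H} γ j j≤ avoid = record { lev = shifted ∘ lev ; lev< = shifted< ; lev-suc = shifted-suc }
  where
  open Grading γ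
  shifted : ℕ → ℕ
  shifted l = if does (l <? j) then l else pred l
  below : ∀ {l} → l < j → shifted l ≡ l
  below {l} l<j rewrite dec-true (l <? j) l<j = refl
  above : ∀ {l} → j ≤ l → shifted l ≡ pred l
  above {l} j≤l rewrite dec-false (l <? j) (≤⇒≯ j≤l) = refl
  shifted< : ∀ x → shifted (lev x) < H
  shifted< x with <-≤-connex (lev x) j
  ... | inj₁ l<j = subst (_< H) (sym (below l<j)) (<-≤-trans l<j j≤)
  ... | inj₂ j≤l = subst (_< H) (sym (above j≤l)) (lem (≤∧≢⇒< j≤l (avoid x ∘ sym)) (lev< x))
    where
    lem : ∀ {l} → j < l → l < suc H → pred l < H
    lem {suc l} _ (s≤s lt) = lt
  shifted-suc : ∀ u w → E u w ≡ true → shifted (lev w) ≡ suc (shifted (lev u))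
  shifted-suc u w e with <-≤-connex (lev u) j
  ... | inj₁ u<j = trans (below w<j) (trans (lev-suc u w e) (cong suc (sym (below u<j))))
    where
    w<j : lev w < j
    w<j = ≤∧≢⇒< (subst (_≤ j) (sym (lev-suc u w e)) u<j) (avoid w)
  ... | inj₂ j≤u = trans (above (≤-trans j≤u (subst (lev u ≤_) (sym (lev-suc u w e)) (n≤1+n _))))
    (trans (cong pred (lev-suc u w e)) (trans (sym (suc-pred (lev u) {{>-nonZero (≤-<-trans z≤n j<u)}})) (cong suc (sym (above j≤u)))))
    where
    j<u : j < lev u
    j<u = ≤∧≢⇒< j≤u (avoid u ∘ sym)

-- Pigeonhole: with more levels than vertices some level is empty and can be deleted.
compress : ∀ {n} {E : Digraph n} H → Grading E H → ∃ λ H′ → H′ ≤ n × Grading E H′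
compress zero γ = 0 , z≤n , γ
compress {n} {E} (suc H) γ with suc H ≤? n
... | yes le = suc H , le , γ
... | no  gt with ∑-<⇒∃ (downFrom (suc H)) few
  where
  open Grading γ
  few : ∑ (downFrom (suc H)) (λ j → # (λ x → j ≡ᵇ lev x) (allFin n)) < ∑ (downFrom (suc H)) (λ _ → 1)
  few = begin-strict
    ∑ (downFrom (suc H)) (λ j → # (λ x → j ≡ᵇ lev x) (allFin n))
      ≤⟨ ∑-fiber-≤ (allFin n) (downFrom (suc H)) (λ x j → j ≡ᵇ lev x) (λ x → #-≟≤1 _≟_ (lev x) (downFrom⁺ (suc H))) ⟩
    length (allFin n)   ≡⟨ length-tabulate (λ x → x) ⟩
    n                             <⟨ ≰⇒> gt ⟩
    suc H                         ≡⟨ trans (∑-const (downFrom (suc H)) 1) (trans (*-identityʳ _) (length-downFrom (suc H))) ⟨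
    ∑ (downFrom (suc H)) (λ _ → 1) ∎
    where open ≤-Reasoning
...   | j , j∈ , empty = compress H (delete-level γ j (≤-pred (∈-downFrom⁻ j∈)) avoid)
  where
  open Grading γ
  avoid : ∀ x → lev x ≢ j
  avoid x e = <-irrefl refl (<-≤-trans empty
    (≤-trans (≤-reflexive (cong 𝟙 (sym (T⁻ (≡⇒≡ᵇ j (lev x) (sym e)))))) (𝟙≤# (λ x → j ≡ᵇ lev x) (∈-allFin x))))

-- Choice of parameters

-- Bernoulli's inequality `(1 - 1 / suc a) ^ t ≥ 1 - t / suc a`, multiplied by `suc a ^ suc t`.
bernoulli : ∀ a t → suc a ^ t * suc a ≤ suc a * a ^ t + t * suc a ^ t
bernoulli a zero    = ≤-reflexive (lem a)
  where
  lem : ∀ a → 1 * suc a ≡ suc a * 1 + 0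
  lem = solve-∀
bernoulli a (suc t) = begin
  suc a * K * suc a                              ≡⟨ *-assoc (suc a) K (suc a) ⟩
  suc a * (K * suc a)                            ≤⟨ *-monoʳ-≤ (suc a) (bernoulli a t) ⟩
  suc a * (suc a * a ^ t + t * K)                ≡⟨ lem₁ a (a ^ t) t K ⟩
  suc a * (a * a ^ t) + t * (suc a * K) + suc a * a ^ t
    ≤⟨ +-monoʳ-≤ (suc a * (a * a ^ t) + t * (suc a * K)) (*-monoʳ-≤ (suc a) (^-monoˡ-≤ t (n≤1+n a))) ⟩
  suc a * (a * a ^ t) + t * (suc a * K) + suc a * K ≡⟨ lem₂ (suc a * (a * a ^ t)) t (suc a * K) ⟩
  suc a * (a * a ^ t) + suc t * (suc a * K)      ∎
  where
  open ≤-Reasoning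
  K = suc a ^ t
  lem₁ : ∀ a p t q → suc a * (suc a * p + t * q) ≡ suc a * (a * p) + t * (suc a * q) + suc a * p
  lem₁ = solve-∀
  lem₂ : ∀ p t q → p + t * q + q ≡ p + suc t * q
  lem₂ = solve-∀

suc^≤2*^ : ∀ a t → 2 * t ≤ suc a → suc a ^ t ≤ 2 * a ^ t
suc^≤2*^ a t h = *-cancelˡ-≤ (suc a) (+-cancelʳ-≤ (suc a * K) _ _ (begin
  suc a * K + suc a * K                 ≡⟨ lem₁ (suc a) K ⟩
  2 * (K * suc a)                       ≤⟨ *-monoʳ-≤ 2 (bernoulli a t) ⟩
  2 * (suc a * a ^ t + t * K)           ≡⟨ lem₂ (suc a) (a ^ t) t K ⟩
  suc a * (2 * a ^ t) + 2 * t * K       ≤⟨ +-monoʳ-≤ (suc a * (2 * a ^ t)) (*-monoˡ-≤ K h) ⟩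
  suc a * (2 * a ^ t) + suc a * K       ∎))
  where
  open ≤-Reasoning
  K = suc a ^ t
  lem₁ : ∀ p q → p * q + p * q ≡ 2 * (q * p)
  lem₁ = solve-∀
  lem₂ : ∀ p q t k → 2 * (p * q + t * k) ≡ p * (2 * q) + 2 * t * k
  lem₂ = solve-∀

n<2^n : ∀ n → n < 2 ^ n
n<2^n zero    = s≤s z≤n
n<2^n (suc n) = begin-strict
  suc n              ≤⟨ n<2^n n ⟩
  2 ^ n              <⟨ m<m+n (2 ^ n) (m^n>0 2 n) ⟩
  2 ^ n + 2 ^ n      ≡⟨ cong (2 ^ n +_) (+-identityʳ (2 ^ n)) ⟨
  2 ^ suc n          ∎
  where open ≤-Reasoning

-- `s = Q` satisfies the first inequality because `Q < 2 ^ Q`. Lower the exponent while the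
-- inequality persists; since `b / a ≤ 3`, the last one overshoots by a factor of at most 3. `1 ≤ Q`
-- stops the descent before 0.
critical-exponent : ∀ Q a b → 1 ≤ Q → .{{_ : NonZero a}} → 2 * a ≤ b → b ≤ 3 * a →
  ∃ λ s → Q * a ^ s < b ^ s × b ^ s ≤ 3 * Q * a ^ s
critical-exponent Q a b 1≤Q 2a≤b b≤3a = go Q (begin-strict
  Q * a ^ Q       <⟨ *-monoˡ-< (a ^ Q) {{m^n≢0 a Q}} (n<2^n Q) ⟩
  2 ^ Q * a ^ Q   ≡⟨ ^-distribʳ-* Q 2 a ⟨
  (2 * a) ^ Q     ≤⟨ ^-monoˡ-≤ Q 2a≤b ⟩
  b ^ Q           ∎)
  where
  open ≤-Reasoning
  go : ∀ k → Q * a ^ k < b ^ k → ∃ λ s → Q * a ^ s < b ^ s × b ^ s ≤ 3 * Q * a ^ s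
  go zero    lt = ⊥-elim (<-irrefl refl (≤-<-trans (≤-trans 1≤Q (≤-reflexive (sym (*-identityʳ Q)))) lt))
  go (suc k) lt with Q * a ^ k <? b ^ k
  ... | yes p = go k p
  ... | no ¬p = suc k , lt , (begin
    b * b ^ k              ≤⟨ *-mono-≤ b≤3a (≮⇒≥ ¬p) ⟩
    3 * a * (Q * a ^ k)    ≡⟨ lem a Q (a ^ k) ⟩
    3 * Q * (a * a ^ k)    ∎)
    where
    lem : ∀ a q p → 3 * a * (q * p) ≡ 3 * q * (a * p)
    lem = solve-∀

-- With ρ = a / (2 (a + 1)), the density guaranteed towards the next level, 1 / B ≤ ρ ^ (2d + 1) is
-- the proportion of common out-neighbours asked of a tuple, and s is least with ρ ^ s < 1 / Q.
module Parameters (d₁ D : ℕ) .{{_ : NonZero D}} where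

  -- `suc a = 8 * d` is at least twice `2 * d + 1`, so `ρ ^ (2 * d + 1)` is at least half of the
  -- same power of 1/2; the extra factor 2 gives the exponent in `B`. In `R`, 6 is 2 for the
  -- averaging times 3 for the overshoot of `s`. In `Q`, `72 = 6 * 6 * 2` absorbs the constants of
  -- `s-large`.
  d a B Q R : ℕ
  d = suc d₁
  a = 7 + 8 * d₁
  B = 2 ^ (2 * d + 2)
  Q = 72 * (D * B)
  R = 6 * Q

  instance
    B≢0 : NonZero B
    B≢0 = m^n≢0 2 (2 * d + 2)
    Q≢0 : NonZero Q
    Q≢0 = m*n≢0 72 (D * B) {{_}} {{m*n≢0 D B}}
    R≢0 : NonZero R
    R≢0 = m*n≢0 6 Q

  ratio^≤B : (2 * suc a) ^ (2 * d + 1) ≤ B * a ^ (2 * d + 1)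
  ratio^≤B = begin
    (2 * suc a) ^ t         ≡⟨ ^-distribʳ-* t 2 (suc a) ⟩
    2 ^ t * suc a ^ t       ≤⟨ *-monoʳ-≤ (2 ^ t) (suc^≤2*^ a t 2t≤) ⟩
    2 ^ t * (2 * a ^ t)     ≡⟨ lem (2 ^ t) (a ^ t) ⟩
    2 ^ suc t * a ^ t       ≡⟨ cong (λ e → 2 ^ e * a ^ t) (sym (+-suc (2 * d) 1)) ⟩
    B * a ^ t               ∎
    where
    open ≤-Reasoning
    t = 2 * d + 1
    lem : ∀ p q → p * (2 * q) ≡ 2 * p * q
    lem = solve-∀
    2t≤ : 2 * t ≤ suc a
    2t≤ = ≤-trans (m≤m+n (2 * t) (2 + 4 * d₁)) (≤-reflexive (lem′ d₁))
      where
      lem′ : ∀ d₁ → 2 * (2 * suc d₁ + 1) + (2 + 4 * d₁) ≡ suc (7 + 8 * d₁)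
      lem′ = solve-∀

  exponent : ∃ λ s → Q * a ^ s < (2 * suc a) ^ s × (2 * suc a) ^ s ≤ 3 * Q * a ^ s
  exponent = critical-exponent Q a (2 * suc a) (>-nonZero⁻¹ Q) (*-monoʳ-≤ 2 (n≤1+n a))
    (≤-trans (≤-reflexive (lem a)) (≤-trans (+-monoʳ-≤ (2 * a) (s≤s (s≤s z≤n))) (≤-reflexive (lem′ a))))
    where
    lem : ∀ a → 2 * suc a ≡ 2 * a + 2
    lem = solve-∀
    lem′ : ∀ a → 2 * a + a ≡ 3 * a
    lem′ = solve-∀

  s = proj₁ exponent

  R-large : 2 * (2 * suc a) ^ s ≤ R * a ^ s
  R-large = ≤-trans (*-monoʳ-≤ 2 (proj₂ (proj₂ exponent))) (≤-reflexive (lem Q (a ^ s)))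
    where
    lem : ∀ q p → 2 * (3 * q * p) ≡ 6 * q * p
    lem = solve-∀

  -- Raising `Q < (1 / ρ) ^ s` to the power `2 * d + 1` puts `Q ^ (2 * d + 1)` below `B ^ s`. Of
  -- these factors `Q`, `suc d` come from `R`, and the other `d`, each equal to `72 * (D * B)`,
  -- absorb the rest of the left side.
  s-large : R ^ suc d * (2 * B) ^ d * D ^ d < B ^ s
  s-large = ≤-<-trans R≤ (*-cancelʳ-< ((a ^ s) ^ t) _ _ (begin-strict
    Q ^ t * (a ^ s) ^ t        ≡⟨ ^-distribʳ-* t Q (a ^ s) ⟨
    (Q * a ^ s) ^ t            <⟨ ^-monoˡ-< t (proj₁ (proj₂ exponent)) ⟩
    ((2 * suc a) ^ s) ^ t      ≡⟨ ^-comm (2 * suc a) s t ⟩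
    ((2 * suc a) ^ t) ^ s      ≤⟨ ^-monoˡ-≤ s ratio^≤B ⟩
    (B * a ^ t) ^ s            ≡⟨ ^-distribʳ-* s B (a ^ t) ⟩
    B ^ s * (a ^ t) ^ s        ≡⟨ cong (B ^ s *_) (^-comm a t s) ⟩
    B ^ s * (a ^ s) ^ t        ∎))
    where
    open ≤-Reasoning
    t = 2 * d + 1
    ^-comm : ∀ x m n → (x ^ m) ^ n ≡ (x ^ n) ^ m
    ^-comm x m n = trans (^-*-assoc x m n) (trans (cong (x ^_) (*-comm m n)) (sym (^-*-assoc x n m)))
    instance
      t≢0 : NonZero t
      t≢0 = _
    R≤ : R ^ suc d * (2 * B) ^ d * D ^ d ≤ Q ^ t
    R≤ = begin
      R ^ suc d * (2 * B) ^ d * D ^ d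
        ≡⟨ cong₂ (λ x y → x * y * D ^ d) (^-distribʳ-* (suc d) 6 Q) (^-distribʳ-* d 2 B) ⟩
      6 * 6 ^ d * Q ^ suc d * (2 ^ d * B ^ d) * D ^ d
        ≡⟨ lem₁ 6 (6 ^ d) (Q ^ suc d) (2 ^ d) (B ^ d) (D ^ d) ⟩
      6 * (6 ^ d * 2 ^ d) * (D ^ d * B ^ d) * Q ^ suc d
        ≤⟨ *-monoˡ-≤ (Q ^ suc d) (*-monoˡ-≤ (D ^ d * B ^ d) (*-monoˡ-≤ (6 ^ d * 2 ^ d) 6≤6^d)) ⟩
      6 ^ d * (6 ^ d * 2 ^ d) * (D ^ d * B ^ d) * Q ^ suc d
        ≡⟨ cong₂ (λ x y → 6 ^ d * x * y * Q ^ suc d) (^-distribʳ-* d 6 2) (^-distribʳ-* d D B) ⟨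
      6 ^ d * 12 ^ d * (D * B) ^ d * Q ^ suc d
        ≡⟨ cong (λ x → x * (D * B) ^ d * Q ^ suc d) (^-distribʳ-* d 6 12) ⟨
      72 ^ d * (D * B) ^ d * Q ^ suc d
        ≡⟨ cong (_* Q ^ suc d) (^-distribʳ-* d 72 (D * B)) ⟨
      Q ^ d * Q ^ suc d
        ≡⟨ ^-distribˡ-+-* Q d (suc d) ⟨
      Q ^ (d + suc d)
        ≡⟨ cong (Q ^_) (lem₂ d) ⟩
      Q ^ t ∎
      where
      6≤6^d : 6 ≤ 6 ^ d
      6≤6^d = m≤m*n 6 (6 ^ d₁) {{m^n≢0 6 d₁}}
      lem₁ : ∀ c p q r x y → c * p * q * (r * x) * y ≡ c * (p * r) * (y * x) * q
      lem₁ = solve-∀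
      lem₂ : ∀ d → d + suc d ≡ 2 * d + 1
      lem₂ = solve-∀

  private
    -- The numerals are variables here, since unification would unfold closed ones.
    collect : ∀ k₁ k₂ k₃ k₄ k₅ k₆ M x n → k₁ * k₂ * k₃ * k₄ * k₅ * k₆ ≤ M → B * B ≡ k₆ * x →
      k₁ * d * (k₂ * B * (k₃ * (k₄ * (D * B)))) * (k₅ * n) ≤ M * D * d ^ 2 * x * n
    collect k₁ k₂ k₃ k₄ k₅ k₆ M x n k≤M B² = begin
      k₁ * d * (k₂ * B * (k₃ * (k₄ * (D * B)))) * (k₅ * n)
        ≡⟨ lem₁ k₁ d k₂ B k₃ k₄ D k₅ n ⟩
      k₁ * k₂ * k₃ * k₄ * k₅ * (D * d) * (B * B) * n
        ≡⟨ cong (λ y → k₁ * k₂ * k₃ * k₄ * k₅ * (D * d) * y * n) B² ⟩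
      k₁ * k₂ * k₃ * k₄ * k₅ * (D * d) * (k₆ * x) * n
        ≡⟨ lem₂ (k₁ * k₂ * k₃ * k₄ * k₅) D d k₆ x n ⟩
      k₁ * k₂ * k₃ * k₄ * k₅ * k₆ * D * d * x * n
        ≤⟨ *-monoˡ-≤ n (*-monoˡ-≤ x (*-mono-≤ (*-monoˡ-≤ D k≤M) (m≤m*n d (d * 1)))) ⟩
      M * D * d ^ 2 * x * n ∎
      where
      open ≤-Reasoning
      lem₁ : ∀ c d e B f g D h n → c * d * (e * B * (f * (g * (D * B)))) * (h * n) ≡ c * e * f * g * h * (D * d) * (B * B) * n
      lem₁ = solve-∀
      lem₂ : ∀ c D d e x n → c * (D * d) * (e * x) * n ≡ c * e * D * d * x * n
      lem₂ = solve-∀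

  length-bound : ∀ {H n} → H ≤ n → 1 ≤ n →
    suc (suc a) * (2 * B * R) * (suc H + n) ≤ 10 ^ 9 * D * d ^ 2 * 2 ^ (4 * d) * n
  length-bound {H} {n} H≤n 1≤n = ≤-trans
    (*-mono-≤ (*-monoˡ-≤ (2 * B * R) 8d+1≤) H+n≤)
    -- 9 is from `8 * d + 1 ≤ 9 * d`, 2 from `width`, 6 from `R`, 72 from `Q`, 3 from
    -- `suc H + n ≤ 3 * n`, and 16 from `B * B`; their product is 373248.
    (collect 9 2 6 72 3 16 (10 ^ 9) (2 ^ (4 * d)) n (≤ᵇ⇒≤ (9 * 2 * 6 * 72 * 3 * 16) (10 ^ 9) _) B²)
    where
    8d+1≤ : suc (suc a) ≤ 9 * d
    8d+1≤ = ≤-trans (m≤m+n (suc (suc a)) d₁) (≤-reflexive (lem d₁))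
      where
      lem : ∀ d₁ → suc (suc (7 + 8 * d₁)) + d₁ ≡ 9 * suc d₁
      lem = solve-∀
    H+n≤ : suc H + n ≤ 3 * n
    H+n≤ = ≤-trans (+-monoˡ-≤ n (+-mono-≤ 1≤n H≤n)) (≤-reflexive (lem n))
      where
      lem : ∀ n → n + n + n ≡ 3 * n
      lem = solve-∀
    B² : B * B ≡ 16 * 2 ^ (4 * d)
    B² = trans (sym (^-distribˡ-+-* 2 (2 * d + 2) (2 * d + 2)))
      (trans (cong (2 ^_) (lem d)) (^-distribˡ-+-* 2 4 (4 * d)))
      where
      lem : ∀ d → 2 * d + 2 + (2 * d + 2) ≡ 4 + 4 * d
      lem = solve-∀

-- Assembling the two bounds

arrows : ∀ {n H} (E : Digraph n) → Grading E H → H ≤ n → 1 ≤ n →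
  ∀ d D → 1 ≤ d → 1 ≤ D → (∀ w → inDeg E w ≤ d) → (∀ u → outDeg E u ≤ D) →
  ∀ N → 10 ^ 9 * D * d ^ 2 * 2 ^ (4 * d) * n ≤ N → Arrows N E
arrows {n} {H} E γ H≤n 1≤n (suc d₁) D _ 1≤D in≤ out≤ N large T tour = embedding (∃-medianOrder T tour (allFin N) (allFin⁺ N))
  where
  open Grading γ
  instance
    D≢0 : NonZero D
    D≢0 = >-nonZero 1≤D
  open Parameters d₁ D
  fits : suc (suc a) * (2 * B * R) * (suc H + n) ≤ N
  fits = ≤-trans (length-bound H≤n 1≤n) large
  x₀ : Fin N
  x₀ = fromℕ< (<-≤-trans (*-mono-< {0} {suc (suc a) * (2 * B * R)} {0} (*-mono-< {0} {suc (suc a)} {0} (s≤s z≤n) (>-nonZero⁻¹ (2 * B * R) {{m*n≢0 (2 * B) R {{m*n≢0 2 B}}}})) (s≤s z≤n)) fits)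
  embedding : (∃ λ ord → allFin N ↭ ord × MedianOrder T tour ord) → Contains T E
  embedding (ord , ord↭ , median) = embed H lev<
    (≤-trans fits (≤-reflexive (trans (sym (length-tabulate (λ x → x))) (↭-length ord↭))))
    where
    open Chain T tour ord median E lev lev-suc d D
      (λ w → ≤-trans (≤-reflexive (#-allFin (λ u → E u w))) (in≤ w))
      (λ u → ≤-trans (≤-reflexive (#-allFin (E u))) (out≤ u))
      (Unique-resp-↭ ord↭ (allFin⁺ N)) x₀ a B R s R-large s-large

bound-mono : ∀ M n {D d Δ} → D ≤ Δ → d ≤ Δ →
  M * D * d ^ 2 * 2 ^ (4 * d) * n ≤ M * Δ ^ 3 * 2 ^ (4 * Δ) * n
bound-mono M n {D} {d} {Δ} D≤ d≤ = *-monoˡ-≤ n (*-mono-≤ (begin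
  M * D * d ^ 2    ≡⟨ *-assoc M D (d ^ 2) ⟩
  M * (D * d ^ 2)  ≤⟨ *-monoʳ-≤ M (*-mono-≤ D≤ (^-monoˡ-≤ 2 d≤)) ⟩
  M * Δ ^ 3        ∎)
  (^-monoʳ-≤ 2 (*-monoʳ-≤ 4 d≤)))
  where open ≤-Reasoning

graded-arrows : ∀ {n} (E : Digraph n) → Graded E → 1 ≤ maxDeg E →
  ∀ N → 10 ^ 9 * maxOutDeg E * maxInDeg E ^ 2 * 2 ^ (4 * maxInDeg E) * n ≤ N → Arrows N E
graded-arrows {n} E (H , level , graded) 1≤Δ N large =
  go (∃-edge E 1≤Δ) (compress H (record { lev = toℕ ∘ level ; lev< = Fin.toℕ<n ∘ level ; lev-suc = graded }))
  where
  go : (∃₂ λ u w → E u w ≡ true) → (∃ λ H′ → H′ ≤ n × Grading E H′) → Arrows N E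
  go (u , w , e) (_ , H′≤n , γ) =
    arrows E γ H′≤n (≤-trans (s≤s z≤n) (Fin.toℕ<n u)) (maxInDeg E) (maxOutDeg E)
      (≤-trans (1≤count (λ u → E u w) e) (≤maxFin (inDeg E) w))
      (≤-trans (1≤count (E u) e) (≤maxFin (outDeg E) u))
      (≤maxFin (inDeg E)) (≤maxFin (outDeg E)) N large

maxOutDeg≤maxDeg : ∀ {n} (E : Digraph n) → maxOutDeg E ≤ maxDeg E
maxOutDeg≤maxDeg E = maxFin-mono (λ v → count-mono {p = E v} {λ u → E v u ∨ E u v} (λ u e → cong (_∨ E u v) e))

maxInDeg≤maxDeg : ∀ {n} (E : Digraph n) → maxInDeg E ≤ maxDeg E
maxInDeg≤maxDeg E = maxFin-mono (λ v → count-mono {p = λ u → E u v} {λ u → E v u ∨ E u v}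
  (λ u e → trans (cong (E v u ∨_) e) (∨-zeroʳ (E v u))))

theorem1p2 : (n : ℕ) (D : Digraph n) → Graded D → 1 ≤ maxDeg D →
    OrientedRamseyAtMost D ((10 ^ 9) * (maxDeg D ^ 3) * (2 ^ (4 * maxDeg D)) * n)
    × OrientedRamseyAtMost D ((10 ^ 9) * maxOutDeg D * (maxInDeg D ^ 2) * (2 ^ (4 * maxInDeg D)) * n)
theorem1p2 n D graded 1≤Δ = both
  (bound-mono (10 ^ 9) n (maxOutDeg≤maxDeg D) (maxInDeg≤maxDeg D))
  (graded-arrows D graded 1≤Δ _ ≤-refl)
  where
  -- The same tournament size, the second bound, witnesses both statements.
  both : ∀ {M₁ M₂} → M₂ ≤ M₁ → Arrows M₂ D → OrientedRamseyAtMost D M₁ × OrientedRamseyAtMost D M₂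
  both {M₂ = M₂} le arr = (M₂ , le , arr) , (M₂ , ≤-refl , arr)
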